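{- Let $n\ge 1$. The characteristic polynomial of the homogenized Shi arrangement $\mathcal{HS}_{2n-1}$ is $$\chi_{\mathcal{HS}_{2n-1}}(t)=t\prod_{i=1}^{n-1}(t-i)^2.$$
   Context: $\mathcal{HS}_{2n-1}$ is the hyperplane arrangement in $\mathbb R^{2n-1}$ with coordinates $(x_1,\dots,x_n,y_1,\dots,y_{n-1})$ given by $\{x_i-x_j=0:1\le i<j\le n\}\cup\{x_i-x_j=y_i:1\le i<j\le n\}$. For a real arrangement $\mathcal A$ in $\mathbb R^d$ with intersection poset $\mathcal L(\mathcal A)$ (nonempty intersections of hyperplanes including $\mathbb R^d$, ordered by reverse inclusion) and Möbius function $\mu$, the characteristic polynomial of the arrangement is $\chi_{\mathcal A}(t)=\sum_{X\in\mathcal L(\mathcal A)}\mu(\mathbb R^d,X)\,t^{\dim X}$. -}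

module Defs where

open import Algebra.Apartness.Bundles using (HeytingCommutativeRing; HeytingField)
open import Algebra.Bundles using (CommutativeRing)
import Algebra.Apartness.Properties.HeytingCommutativeRing as HeytingProperties
import Algebra.Definitions.RawMonoid as RawMonoidDefinitions
open import Data.Bool.Base using (if_then_else_)
open import Data.Fin.Base using (Fin; toℕ; fromℕ<; _↑ˡ_; _↑ʳ_)
import Data.Fin.Base as Fin
import Data.Fin.Properties as Fin
open import Data.Integer.Base using (ℤ; +_; 0ℤ; 1ℤ)
import Data.Integer.Base as ℤ
open import Data.List.Base
  using (List; []; _∷_; _++_; map; foldr; replicate; applyUpTo; allFin; cartesianProduct; mapMaybe)
import Data.List.Membership.Setoid as SetoidMembership
open import Data.List.Relation.Binary.Subset.Propositional using (_⊆_)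
open import Data.List.Relation.Unary.All using (All; [])
import Data.List.Relation.Unary.Unique.Setoid as SetoidUnique
open import Data.Maybe.Base using (Maybe; just; nothing)
open import Data.Nat.Base using (ℕ; zero; suc; pred)
import Data.Nat.Base as ℕ
import Data.Nat.Properties as ℕ
open import Data.Product.Base using (Σ-syntax; ∃; ∃-syntax; _×_; _,_; proj₁; proj₂)
open import Data.Sum.Base using (_⊎_)
open import Data.Vec.Functional using (Vector)
open import Function.Base using (_∘_)
open import Function.Bundles using (_⇔_)
open import Level using (_⊔_)
import Level
open import Relation.Binary.Bundles using (Poset)
open import Relation.Binary.Core using (Rel)
open import Relation.Binary.PropositionalEquality.Core using (_≡_; refl; sym; subst)
import Relation.Binary.PropositionalEquality.Core as ≡
open import Relation.Binary.Structures using (IsStrictPartialOrder)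
open import Relation.Nullary.Decidable using (does; yes; no; dec-true; dec-false)
open import Relation.Nullary.Negation using (¬_)
open import Relation.Unary using (Pred)

------------------------------------------------------------------------
-- Real numbers

-- The standard library has no type of real numbers.  ℝ is axiomatised as a
-- Cauchy complete Archimedean ordered field, which determines it up to
-- isomorphism.  Apartness and setoid equality are used, so that the
-- constructive real numbers are a model, as are the classical ones
-- (with x # y meaning x ≠ y).

module _ {c ℓ₁ ℓ₂ ℓ₃} (K : HeytingField c ℓ₁ ℓ₂)
         (_<_ : Rel (HeytingField.Carrier K) ℓ₃) where
  open HeytingField K
  open HeytingCommutativeRing heytingCommutativeRing using (commutativeRing)
  open CommutativeRing commutativeRing using (+-rawMonoid)
  open RawMonoidDefinitions +-rawMonoid using () renaming (_×_ to _·_)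

  record IsOrderedField : Set (c ⊔ ℓ₁ ⊔ ℓ₂ ⊔ ℓ₃) where
    field
      isStrictPartialOrder : IsStrictPartialOrder _≈_ _<_
      <⇒#                  : ∀ {x y} → x < y → x # y
      #⇒<⊎>                : ∀ {x y} → x # y → x < y ⊎ y < x
      +-monoˡ-<            : ∀ z {x y} → x < y → (x + z) < (y + z)
      *-pos                : ∀ {x y} → 0# < x → 0# < y → 0# < (x * y)

  Archimedean : Set (c ⊔ ℓ₃)
  Archimedean = ∀ x → ∃[ n ] x < (n · 1#)

  -- ∣ x − y ∣ < ε
  Within : Carrier → Rel Carrier ℓ₃
  Within ε x y = (x - y) < ε × (y - x) < ε

  IsCauchy : (ℕ → Carrier) → Set (c ⊔ ℓ₃)
  IsCauchy s = ∀ ε → 0# < ε →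
    ∃[ N ] ∀ m n → N ℕ.≤ m → N ℕ.≤ n → Within ε (s m) (s n)

  ConvergesTo : (ℕ → Carrier) → Carrier → Set (c ⊔ ℓ₃)
  ConvergesTo s L = ∀ ε → 0# < ε → ∃[ N ] ∀ n → N ℕ.≤ n → Within ε (s n) L

  CauchyComplete : Set (c ⊔ ℓ₃)
  CauchyComplete = ∀ s → IsCauchy s → ∃ (ConvergesTo s)

record RealNumbers c ℓ₁ ℓ₂ ℓ₃ : Set (Level.suc (c ⊔ ℓ₁ ⊔ ℓ₂ ⊔ ℓ₃)) where
  field
    heytingField   : HeytingField c ℓ₁ ℓ₂
    _<_            : Rel (HeytingField.Carrier heytingField) ℓ₃
    isOrderedField : IsOrderedField heytingField _<_
    archimedean    : Archimedean heytingField _<_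
    cauchyComplete : CauchyComplete heytingField _<_

------------------------------------------------------------------------
-- Polynomials in t with integer coefficients

-- Coefficient lists, constant term first; trailing zeros are allowed and
-- are ignored by _≈ₚ_.

ℤ[t] : Set
ℤ[t] = List ℤ

coeff : ℤ[t] → ℕ → ℤ
coeff []      _       = 0ℤ
coeff (a ∷ p) zero    = a
coeff (a ∷ p) (suc k) = coeff p k

infix  4 _≈ₚ_
infixl 6 _+ₚ_
infixl 7 _*ₚ_
infixr 8 _^ₚ_

_≈ₚ_ : ℤ[t] → ℤ[t] → Set
p ≈ₚ q = ∀ k → coeff p k ≡ coeff q k

_+ₚ_ : ℤ[t] → ℤ[t] → ℤ[t]
[]      +ₚ q       = q
(a ∷ p) +ₚ []      = a ∷ p
(a ∷ p) +ₚ (b ∷ q) = (a ℤ.+ b) ∷ (p +ₚ q)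

_*ₚ_ : ℤ[t] → ℤ[t] → ℤ[t]
[]      *ₚ q = []
(a ∷ p) *ₚ q = map (a ℤ.*_) q +ₚ (0ℤ ∷ (p *ₚ q))

1ₚ : ℤ[t]
1ₚ = 1ℤ ∷ []

_^ₚ_ : ℤ[t] → ℕ → ℤ[t]
p ^ₚ zero  = 1ₚ
p ^ₚ suc k = p *ₚ (p ^ₚ k)

monomial : ℤ → ℕ → ℤ[t]
monomial a k = replicate k 0ℤ ++ (a ∷ [])

t : ℤ[t]
t = monomial 1ℤ 1

t-_ : ℕ → ℤ[t]
t- i = ℤ.- (+ i) ∷ 1ℤ ∷ []

∑ₚ : List ℤ[t] → ℤ[t]
∑ₚ = foldr _+ₚ_ []

-- ∏₁ m f = f 1 · f 2 ⋯ f m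
∏₁ : ℕ → (ℕ → ℤ[t]) → ℤ[t]
∏₁ m f = foldr _*ₚ_ 1ₚ (map f (applyUpTo suc m))

------------------------------------------------------------------------
-- The Möbius function

module _ {c ℓ₁ ℓ₂} (P : Poset c ℓ₁ ℓ₂) where
  open Poset P
  open SetoidMembership Eq.setoid using (_∈_)
  open SetoidUnique Eq.setoid using (Unique)

  -- xs lists the elements satisfying Q, each exactly once up to _≈_.
  Lists : ∀ {ℓ} → Pred Carrier ℓ → List Carrier → Set _
  Lists Q xs = Unique xs × (∀ x → x ∈ xs ⇔ Q x)

  -- μ is the function y ↦ μ(a , y) on { y ∣ a ≤ y }: μ(a , a) = 1, and for
  -- a < y the interval [a , y] is finite and Σ_{a ≤ z ≤ y} μ(a , z) = 0.
  -- The values of μ outside { y ∣ a ≤ y } are irrelevant.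
  record IsMöbiusFrom (a : Carrier) (μ : Carrier → ℤ) : Set (c ⊔ ℓ₁ ⊔ ℓ₂) where
    field
      cong : ∀ {x y} → x ≈ y → μ x ≡ μ y
      base : μ a ≡ 1ℤ
      sum  : ∀ {y} → a ≤ y → ¬ (a ≈ y) →
             ∃[ zs ] Lists (λ z → a ≤ z × z ≤ y) zs ×
                     foldr ℤ._+_ 0ℤ (map μ zs) ≡ 0ℤ

------------------------------------------------------------------------
-- Hyperplane arrangements

module Arrangements {c ℓ₁ ℓ₂} (K : HeytingField c ℓ₁ ℓ₂) where
  open HeytingField K hiding (refl; sym)
  open HeytingField K using () renaming (refl to ≈-refl; sym to ≈-sym)
  open HeytingCommutativeRing heytingCommutativeRing using (commutativeRing)
  open CommutativeRing commutativeRing using (+-rawMonoid)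
  open RawMonoidDefinitions +-rawMonoid using (sum)

  Point : ℕ → Set c
  Point d = Vector Carrier d

  -- The affine hyperplane { x ∣ Σₖ normal k · x k = offset }.
  record Hyperplane (d : ℕ) : Set (c ⊔ ℓ₂) where
    field
      normal  : Vector Carrier d
      offset  : Carrier
      nonzero : ∃[ k ] normal k # 0#

  _liesOn_ : ∀ {d} → Point d → Hyperplane d → Set ℓ₁
  x liesOn H = sum (λ k → normal k * x k) ≈ offset
    where open Hyperplane H

  -- An arrangement is the finite set of hyperplanes occurring in the list.
  Arrangement : ℕ → Set (c ⊔ ℓ₂)
  Arrangement d = List (Hyperplane d)

  ⋂ : ∀ {d} → List (Hyperplane d) → Pred (Point d) (c ⊔ ℓ₁ ⊔ ℓ₂)
  ⋂ Hs x = All (x liesOn_) Hs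

  combination : ∀ {d k} → Vector Carrier k → Vector (Point d) k → Point d
  combination a v j = sum (λ i → a i * v i j)

  LinearlyIndependent : ∀ {d k} → Vector (Point d) k → Set (c ⊔ ℓ₁)
  LinearlyIndependent v =
    ∀ a → (∀ j → combination a v j ≈ 0#) → ∀ i → a i ≈ 0#

  -- X = p + span v for some point p and linearly independent v₁, …, vₖ.
  HasDimension : ∀ {d ℓ} → Pred (Point d) ℓ → ℕ → Set (c ⊔ ℓ₁ ⊔ ℓ)
  HasDimension {d} X k =
    Σ[ p ∈ Point d ] Σ[ v ∈ Vector (Point d) k ] LinearlyIndependent v ×
      (∀ x → X x ⇔ (Σ[ a ∈ Vector Carrier k ] ∀ j → x j ≈ p j + combination a v j))

  module _ {d : ℕ} (A : Arrangement d) where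

    -- The elements of 𝓛(A).
    record Flat : Set (c ⊔ ℓ₁ ⊔ ℓ₂) where
      field
        hyperplanes : List (Hyperplane d)
        ⊆A          : hyperplanes ⊆ A
        nonempty    : ∃ (⋂ hyperplanes)

    ⟦_⟧ : Flat → Pred (Point d) (c ⊔ ℓ₁ ⊔ ℓ₂)
    ⟦ X ⟧ = ⋂ (Flat.hyperplanes X)

    -- Flats are equal when they are equal as sets of points, and are ordered
    -- by reverse inclusion.
    𝓛 : Poset (c ⊔ ℓ₁ ⊔ ℓ₂) (c ⊔ ℓ₁ ⊔ ℓ₂) (c ⊔ ℓ₁ ⊔ ℓ₂)
    𝓛 = record
      { Carrier = Flat
      ; _≈_     = λ X Y → (∀ x → ⟦ X ⟧ x → ⟦ Y ⟧ x) × (∀ x → ⟦ Y ⟧ x → ⟦ X ⟧ x)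
      ; _≤_     = λ X Y → ∀ x → ⟦ Y ⟧ x → ⟦ X ⟧ x
      ; isPartialOrder = record
        { isPreorder = record
          { isEquivalence = record
            { refl  = (λ _ z → z) , (λ _ z → z)
            ; sym   = λ (f , g) → g , f
            ; trans = λ (f , g) (h , k) → (λ x → h x ∘ f x) , (λ x → g x ∘ k x)
            }
          ; reflexive = proj₂
          ; trans     = λ f g x → f x ∘ g x
          }
        ; antisym = λ f g → g , f
        }
      }

    whole : Flat
    whole = record
      { hyperplanes = []
      ; ⊆A          = λ ()
      ; nonempty    = (λ _ → 0#) , []
      }

    -- What the sum Σ_{X ∈ 𝓛(A)} μ(whole , X) t^{dim X} refers to.  All of it
    -- is determined by A, except for the order of the list of flats and the
    -- choice of their representatives.
    record IntersectionData : Set (c ⊔ ℓ₁ ⊔ ℓ₂) where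
      field
        flats    : List Flat
        unique   : SetoidUnique.Unique (Poset.Eq.setoid 𝓛) flats
        complete : ∀ X → SetoidMembership._∈_ (Poset.Eq.setoid 𝓛) X flats
        μ        : Flat → ℤ
        isMöbius : IsMöbiusFrom 𝓛 whole μ
        dim      : Flat → ℕ
        isDim    : ∀ X → HasDimension ⟦ X ⟧ (dim X)

      χ : ℤ[t]
      χ = ∑ₚ (map (λ X → monomial (μ X) (dim X)) flats)

    -- χ_A = p
    IsCharacteristicPolynomial : ℤ[t] → Set (c ⊔ ℓ₁ ⊔ ℓ₂)
    IsCharacteristicPolynomial p =
      Σ[ D ∈ IntersectionData ] IntersectionData.χ D ≈ₚ p

  ----------------------------------------------------------------------
  -- The homogenized Shi arrangement

  -- The coordinate functions, as covectors: x₁, …, xₙ come first, followed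
  -- by y₁, …, yₙ₋₁, for a total of n + (n − 1) coordinates.  Indices start
  -- from 0 in Fin.

  coordinate : ∀ {d} → Fin d → Vector Carrier d
  coordinate i k = if does (i Fin.≟ k) then 1# else 0#

  module _ (n : ℕ) where

    x : Fin n → Vector Carrier (n ℕ.+ pred n)
    x i = coordinate (i ↑ˡ pred n)

    y : Fin (pred n) → Vector Carrier (n ℕ.+ pred n)
    y i = coordinate (n ↑ʳ i)

  record IndexPair (n : ℕ) : Set where
    constructor pair
    field
      i j : Fin n
      i<j : i Fin.< j

    -- i regarded as an index of the coordinates y.
    i′ : Fin (pred n)
    i′ = fromℕ< (ℕ.<-≤-trans i<j (Fin.toℕ≤pred[n] j))

  increasing : ∀ {n} → Fin n × Fin n → Maybe (IndexPair n)
  increasing (i , j) with i Fin.<? j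
  ... | yes i<j = just (pair i j i<j)
  ... | no  _   = nothing

  -- Every pair i < j, exactly once.
  indexPairs : ∀ n → List (IndexPair n)
  indexPairs n = mapMaybe increasing (cartesianProduct (allFin n) (allFin n))

  private
    open HeytingProperties heytingCommutativeRing using (1#0; #-congʳ; x-0≈x)

    coordinate-≡ : ∀ {d} (i : Fin d) → coordinate i i ≡ 1#
    coordinate-≡ i rewrite dec-true (i Fin.≟ i) refl = refl

    coordinate-≢ : ∀ {d} {i k : Fin d} → ¬ (i ≡ k) → coordinate i k ≡ 0#
    coordinate-≢ {i = i} {k} i≢k rewrite dec-false (i Fin.≟ k) i≢k = refl

    ↑ˡ≢↑ʳ : ∀ m n (i : Fin m) (j : Fin n) → ¬ (i ↑ˡ n ≡ m ↑ʳ j)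
    ↑ˡ≢↑ʳ m n i j eq = ℕ.<⇒≱ (Fin.toℕ<n i)
      (subst (m ℕ.≤_) toℕ≡ (ℕ.m≤m+n m (toℕ j)))
      where
      toℕ≡ : m ℕ.+ toℕ j ≡ toℕ i
      toℕ≡ = ≡.trans (sym (Fin.toℕ-↑ʳ m j)) (≡.trans (sym (≡.cong toℕ eq)) (Fin.toℕ-↑ˡ i n))

    i≢j : ∀ {n} (e : IndexPair n) → ¬ (IndexPair.j e ↑ˡ pred n ≡ IndexPair.i e ↑ˡ pred n)
    i≢j {n} (pair i j i<j) eq = Fin.<⇒≢ i<j (sym (Fin.↑ˡ-injective (pred n) j i eq))

  -- The hyperplanes xᵢ − xⱼ = 0 and xᵢ − xⱼ − yᵢ = 0.

  braid : ∀ {n} → IndexPair n → Hyperplane (n ℕ.+ pred n)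
  braid {n} e = record
    { normal  = λ k → x n i k - x n j k
    ; offset  = 0#
    ; nonzero = i ↑ˡ pred n , nonzero
    }
    where
    open IndexPair e
    nonzero : x n i (i ↑ˡ pred n) - x n j (i ↑ˡ pred n) # 0#
    nonzero rewrite coordinate-≡ (i ↑ˡ pred n) | coordinate-≢ (i≢j e) =
      #-congʳ (≈-sym (x-0≈x 1#)) 1#0

  shi : ∀ {n} → IndexPair n → Hyperplane (n ℕ.+ pred n)
  shi {n} e = record
    { normal  = λ k → x n i k - x n j k - y n i′ k
    ; offset  = 0#
    ; nonzero = i ↑ˡ pred n , nonzero
    }
    where
    open IndexPair e
    nonzero : x n i (i ↑ˡ pred n) - x n j (i ↑ˡ pred n) - y n i′ (i ↑ˡ pred n) # 0#
    nonzero rewrite coordinate-≡ (i ↑ˡ pred n) | coordinate-≢ (i≢j e)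
                  | coordinate-≢ (↑ˡ≢↑ʳ n (pred n) i i′ ∘ sym) =
      #-congʳ (≈-sym (trans (x-0≈x _) (x-0≈x 1#))) 1#0

  -- 𝓗𝓢 n lives in dimension n + (n − 1) = 2n − 1.
  𝓗𝓢 : ∀ n → Arrangement (n ℕ.+ pred n)
  𝓗𝓢 n = map braid (indexPairs n) ++ map shi (indexPairs n)

-- In the coordinates xᵢ and zᵢ = xᵢ − yᵢ the hyperplanes are xᵢ = xⱼ and zᵢ = xⱼ,
-- for i < j.  This is the graphic arrangement of a chordal graph: ordering the
-- vertices by decreasing index, the earlier neighbours xⱼ, j > i, of xᵢ and of
-- zᵢ form a clique.
--
-- Let a forest F choose for each vertex at most one edge to an earlier
-- neighbour.  Every flat is the intersection φ F of the edges of some forest,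
-- and φ F has one dimension for each vertex without a choice.  Moreover,
-- μ X = Σ (−1)^∣F∣, summed over the forests F with φ F = X.  Indeed, the sum of
-- μ below Y is the sum of (−1)^∣F∣ over the forests all of whose edges contain Y,
-- which factors as ∏ᵥ (1 − #{edges from v to earlier neighbours that contain Y}).
-- If Y is not the whole space, consider the first v where this number is not 0:
-- it is 1, because two such neighbours of v would be adjacent, and the edge
-- between them would contain Y as well.  By the same factorisation
-- χ = Σ (−1)^∣F∣ t^(dim φ F) = ∏ᵥ (t − deg v), with deg v the number of earlier
-- neighbours.

module Submission where

open import Defs
open import Algebra.Apartness.Bundles using (HeytingCommutativeRing; HeytingField)
import Algebra.Apartness.Properties.HeytingCommutativeRing as HeytingProperties
open import Algebra.Bundles using (CommutativeMonoid; CommutativeRing)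
import Algebra.Properties.AbelianGroup as AbelianGroupProperties
import Algebra.Properties.CommutativeSemigroup as CommutativeSemigroupProperties
import Algebra.Properties.Ring as RingProperties
import Algebra.Properties.Semiring.Sum as SemiringSum
open import Data.Bool.Base using (Bool; true; false; if_then_else_)
open import Data.Fin.Base using (Fin; zero; suc; toℕ; inject₁; splitAt; _↑ˡ_; _↑ʳ_)
import Data.Fin.Base as Fin
import Data.Fin.Properties as Fin
open import Data.Integer.Base using (ℤ; +_; 0ℤ; 1ℤ; -1ℤ)
import Data.Integer.Base as ℤ
import Data.Integer.Properties as ℤ
open import Data.Integer.Tactic.RingSolver using (solve-∀)
open import Data.List.Base
  using (List; []; _∷_; _++_; map; foldr; filter; length; lookup; tabulate; allFin; concat;
         concatMap; deduplicate; cartesianProduct; cartesianProductWith; applyUpTo; downFrom; applyDownFrom)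
open import Data.List.Membership.Propositional using (_∈_)
open import Data.List.Membership.Propositional.Properties
  using (∈-lookup; ∈-allFin; ∈-filter⁺; ∈-filter⁻; ∈-tabulate⁺; ∈-tabulate⁻; ∈-map⁺; ∈-map⁻;
         ∈-++⁺ˡ; ∈-++⁺ʳ; ∈-++⁻; ∈-cartesianProduct⁺; ∈-cartesianProductWith⁺)
import Data.List.Membership.Setoid as SetoidMembership
import Data.List.Membership.Setoid.Properties as SetoidMembershipProperties
import Data.List.Properties as List
open import Data.List.Relation.Binary.Permutation.Propositional
  using (_↭_; ↭-refl; ↭-reflexive; refl; prep; swap; trans; module PermutationReasoning)
import Data.List.Relation.Binary.Permutation.Propositional.Properties as ↭
open import Data.List.Relation.Binary.Subset.Propositional using (_⊆_)
open import Data.List.Relation.Unary.All using (All; []; _∷_)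
import Data.List.Relation.Unary.All as All
import Data.List.Relation.Unary.All.Properties as All
open import Data.List.Relation.Unary.AllPairs using ([]; _∷_)
open import Data.List.Relation.Unary.Any using (here; there)
import Data.List.Relation.Unary.Any as Any
import Data.List.Relation.Unary.Any.Properties as Any
import Data.List.Relation.Unary.Unique.DecSetoid.Properties as DecSetoidUnique
open import Data.List.Relation.Unary.Unique.Propositional using (Unique)
import Data.List.Relation.Unary.Unique.Propositional.Properties as Unique
import Data.List.Relation.Unary.Unique.Setoid as SetoidUnique
import Data.List.Relation.Unary.Unique.Setoid.Properties as SetoidUniqueProperties
open import Data.Maybe.Base using (Maybe; just; nothing; is-nothing)
open import Data.Maybe.Relation.Unary.Any using (just)
import Data.Maybe.Relation.Unary.Any as Maybe
open import Data.Nat.Base using (ℕ; zero; suc; pred; _≤_; _<_; s≤s; z≤n; _∸_)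
import Data.Nat.Base as ℕ
open import Data.Nat.Induction using (<-wellFounded)
import Data.Nat.Properties as ℕ
open import Data.Product.Base using (∃; ∃₂; _×_; _,_; proj₁; proj₂)
open import Data.Sum.Base using (_⊎_; inj₁; inj₂; [_,_]′)
open import Data.Unit.Polymorphic.Base using (⊤; tt)
open import Data.Vec.Functional using (Vector)
open import Function.Base using (_∘_)
open import Function.Bundles using (_⇔_; mk⇔; Equivalence)
open import Induction.WellFounded using (Acc; acc)
open import Level using (_⊔_)
open import Relation.Binary.Bundles using (DecSetoid; Poset)
open import Relation.Binary.Definitions using (tri<; tri≈; tri>)
open import Relation.Binary.PropositionalEquality
  using (_≡_; _≢_; refl; sym; cong; cong₂; subst; module ≡-Reasoning)
import Relation.Binary.PropositionalEquality as ≡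
import Relation.Binary.Reasoning.Setoid as ≈-Reasoning
open import Relation.Nullary.Decidable
  using (Dec; does; yes; no; dec-true; dec-false; map′; _→-dec_; _×-dec_)
open import Relation.Nullary.Negation using (¬_; contradiction)
open import Relation.Unary using (Decidable)

-- Finite sums of integers

module IntegerSums where
  open import Data.Integer.Base using (_+_; _*_; -_)

  module _ {a} {A : Set a} where

    ∑ : List A → (A → ℤ) → ℤ
    ∑ xs f = foldr _+_ 0ℤ (map f xs)

    ∑-cong : ∀ xs {f g : A → ℤ} → (∀ x → f x ≡ g x) → ∑ xs f ≡ ∑ xs g
    ∑-cong xs f≗g = cong (foldr _+_ 0ℤ) (List.map-cong f≗g xs)

    ∑-++ : ∀ xs ys f → ∑ (xs ++ ys) f ≡ ∑ xs f + ∑ ys f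
    ∑-++ []       ys f = sym (ℤ.+-identityˡ _)
    ∑-++ (x ∷ xs) ys f = ≡.trans (cong (_+_ (f x)) (∑-++ xs ys f)) (sym (ℤ.+-assoc (f x) _ _))

    ∑-*ˡ : ∀ xs c f → ∑ xs (λ x → c * f x) ≡ c * ∑ xs f
    ∑-*ˡ []       c f = sym (ℤ.*-zeroʳ c)
    ∑-*ˡ (x ∷ xs) c f = ≡.trans (cong (_+_ (c * f x)) (∑-*ˡ xs c f)) (sym (ℤ.*-distribˡ-+ c (f x) _))

    ∑-*ʳ : ∀ xs f c → ∑ xs (λ x → f x * c) ≡ ∑ xs f * c
    ∑-*ʳ xs f c = ≡.trans (∑-cong xs (λ x → ℤ.*-comm (f x) c))
                          (≡.trans (∑-*ˡ xs c f) (ℤ.*-comm c _))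

    ∑-0 : ∀ xs → ∑ xs (λ _ → 0ℤ) ≡ 0ℤ
    ∑-0 []       = refl
    ∑-0 (x ∷ xs) = ≡.trans (ℤ.+-identityˡ _) (∑-0 xs)

    ∑-+ : ∀ xs f g → ∑ xs (λ x → f x + g x) ≡ ∑ xs f + ∑ xs g
    ∑-+ []       f g = refl
    ∑-+ (x ∷ xs) f g = ≡.trans (cong (_+_ (f x + g x)) (∑-+ xs f g)) (interchange (f x) (g x) _ _)
      where
      interchange : ∀ p q r s → (p + q) + (r + s) ≡ (p + r) + (q + s)
      interchange = solve-∀

  module _ {a b} {A : Set a} {B : Set b} where

    ∑-map : ∀ xs (g : A → B) f → ∑ (map g xs) f ≡ ∑ xs (f ∘ g)
    ∑-map xs g f = cong (foldr _+_ 0ℤ) (sym (List.map-∘ xs))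

    ∑-swap : ∀ xs ys (f : A → B → ℤ) →
             ∑ xs (λ x → ∑ ys (f x)) ≡ ∑ ys (λ y → ∑ xs (λ x → f x y))
    ∑-swap []       ys f = sym (∑-0 ys)
    ∑-swap (x ∷ xs) ys f =
      ≡.trans (cong (_+_ (∑ ys (f x))) (∑-swap xs ys f)) (sym (∑-+ ys (f x) _))

  ∑-cartesianProductWith : ∀ {a b c} {A : Set a} {B : Set b} {C : Set c} (h : A → B → C) xs ys f →
    ∑ (cartesianProductWith h xs ys) f ≡ ∑ xs (λ x → ∑ ys (λ y → f (h x y)))
  ∑-cartesianProductWith h []       ys f = refl
  ∑-cartesianProductWith h (x ∷ xs) ys f =
    ≡.trans (∑-++ (map (h x) ys) _ f)
            (cong₂ _+_ (∑-map ys (h x) f) (∑-cartesianProductWith h xs ys f))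

  module _ {p} {P : Set p} where

    -- The Iverson bracket. It moves a condition on the index into the summand, so that sums can be
    -- exchanged and factored.
    𝟙 : Dec P → ℤ
    𝟙 P? = if does P? then 1ℤ else 0ℤ

    𝟙-true : (P? : Dec P) → P → 𝟙 P? ≡ 1ℤ
    𝟙-true P? p = cong (if_then 1ℤ else 0ℤ) (dec-true P? p)

    𝟙-false : (P? : Dec P) → ¬ P → 𝟙 P? ≡ 0ℤ
    𝟙-false P? ¬p = cong (if_then 1ℤ else 0ℤ) (dec-false P? ¬p)

  𝟙-cong : ∀ {p q} {P : Set p} {Q : Set q} (P? : Dec P) (Q? : Dec Q) →
           (P → Q) → (Q → P) → 𝟙 P? ≡ 𝟙 Q?
  𝟙-cong P? (yes q) P⇒Q Q⇒P = 𝟙-true P? (Q⇒P q)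
  𝟙-cong P? (no ¬q) P⇒Q Q⇒P = 𝟙-false P? (¬q ∘ P⇒Q)

  module _ {a p} {A : Set a} {P : A → Set p} (P? : Decidable P) where

    ∑-filter : ∀ xs f → ∑ (filter P? xs) f ≡ ∑ xs (λ x → f x * 𝟙 (P? x))
    ∑-filter []       f = refl
    ∑-filter (x ∷ xs) f with does (P? x)
    ... | true  = cong₂ _+_ (sym (ℤ.*-identityʳ (f x))) (∑-filter xs f)
    ... | false = ≡.trans (∑-filter xs f)
      (sym (≡.trans (cong (_+ _) (ℤ.*-zeroʳ (f x))) (ℤ.+-identityˡ _)))

    ∑-𝟙 : ∀ xs → ∑ xs (λ x → 𝟙 (P? x)) ≡ + length (filter P? xs)
    ∑-𝟙 []       = refl
    ∑-𝟙 (x ∷ xs) with does (P? x)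
    ... | true  = cong (_+_ 1ℤ) (∑-𝟙 xs)
    ... | false = ≡.trans (ℤ.+-identityˡ _) (∑-𝟙 xs)

  module _ {a ℓ} (S : DecSetoid a ℓ) where
    open DecSetoid S renaming (Carrier to A; refl to ≈-refl; sym to ≈-sym; trans to ≈-trans)
    open SetoidMembership setoid using () renaming (_∈_ to _∈ₛ_)
    open SetoidUnique setoid using () renaming (Unique to Uniqueₛ)

    -- The list meets the class of `x` in exactly one entry, perhaps a representative other than
    -- `x`; this is where `g` has to respect the equivalence.
    ∑-unique : ∀ {xs x} (g : A → ℤ) → (∀ {y z} → y ≈ z → g y ≡ g z) →
               Uniqueₛ xs → x ∈ₛ xs → ∑ xs (λ y → 𝟙 (x ≟ y) * g y) ≡ g x
    ∑-unique {y ∷ ys} {x} g g-cong (y∉ys ∷ _) (here x≈y) = begin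
      𝟙 (x ≟ y) * g y + ∑ ys (λ z → 𝟙 (x ≟ z) * g z)
        ≡⟨ cong₂ _+_ (≡.trans (cong (_* g y) (𝟙-true (x ≟ y) x≈y)) (ℤ.*-identityˡ (g y)))
                     (vanishes ys y∉ys) ⟩
      g y + 0ℤ  ≡⟨ ℤ.+-identityʳ _ ⟩
      g y       ≡⟨ g-cong x≈y ⟨
      g x       ∎
      where
      open ≡-Reasoning
      vanishes : ∀ zs → All (λ z → ¬ (y ≈ z)) zs → ∑ zs (λ z → 𝟙 (x ≟ z) * g z) ≡ 0ℤ
      vanishes []       []           = refl
      vanishes (z ∷ zs) (y≉z ∷ y∉zs) =
        cong₂ _+_ (cong (_* g z) (𝟙-false (x ≟ z) λ x≈z → y≉z (≈-trans (≈-sym x≈y) x≈z)))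
                  (vanishes zs y∉zs)
    ∑-unique {y ∷ ys} {x} g g-cong (y∉ys ∷ ys!) (there x∈ys) =
      ≡.trans (cong₂ _+_ (cong (_* g y) (𝟙-false (x ≟ y) (x≉y ys y∉ys x∈ys)))
                         (∑-unique g g-cong ys! x∈ys))
              (ℤ.+-identityˡ _)
      where
      x≉y : ∀ zs → All (λ z → ¬ (y ≈ z)) zs → x ∈ₛ zs → ¬ (x ≈ y)
      x≉y (z ∷ zs) (y≉z ∷ _) (here x≈z)   x≈y = y≉z (≈-trans (≈-sym x≈y) x≈z)
      x≉y (z ∷ zs) (_ ∷ p)   (there x∈zs) x≈y = x≉y zs p x∈zs x≈y

  -- Finite products and sums over choice functions

  ∏ : ∀ {d} → (Fin d → ℤ) → ℤ
  ∏ {zero}  f = 1ℤ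
  ∏ {suc d} f = f zero * ∏ (f ∘ suc)

  ∏-cong : ∀ {d} {f g : Fin d → ℤ} → (∀ v → f v ≡ g v) → ∏ f ≡ ∏ g
  ∏-cong {zero}  f≗g = refl
  ∏-cong {suc d} f≗g = cong₂ _*_ (f≗g zero) (∏-cong (f≗g ∘ suc))

  ∏-zero : ∀ {d} (f : Fin d → ℤ) v → f v ≡ 0ℤ → ∏ f ≡ 0ℤ
  ∏-zero f zero    fv≡0 = cong (_* ∏ (f ∘ suc)) fv≡0
  ∏-zero f (suc v) fv≡0 = ≡.trans (cong (f zero *_) (∏-zero (f ∘ suc) v fv≡0)) (ℤ.*-zeroʳ (f zero))

  ∏-one : ∀ {d} (f : Fin d → ℤ) → (∀ v → f v ≡ 1ℤ) → ∏ f ≡ 1ℤ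
  ∏-one {zero}  f f≡1 = refl
  ∏-one {suc d} f f≡1 = cong₂ _*_ (f≡1 zero) (∏-one (f ∘ suc) (f≡1 ∘ suc))

  -- Over a finite index set, failure of the conjunction yields an explicit failing `v`, whose
  -- factor is 0.
  ∏-𝟙 : ∀ {d p} {P : Fin d → Set p} (P? : Decidable P) (all? : Dec (∀ v → P v)) f →
        ∏ (λ v → f v * 𝟙 (P? v)) ≡ ∏ f * 𝟙 all?
  ∏-𝟙 P? (yes p) f = ≡.trans
    (∏-cong λ v → ≡.trans (cong (f v *_) (𝟙-true (P? v) (p v))) (ℤ.*-identityʳ (f v)))
    (sym (ℤ.*-identityʳ _))
  ∏-𝟙 {d} {P = P} P? (no ¬p) f with v , ¬Pv ← Fin.¬∀⟶∃¬ d P P? ¬p =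
    ≡.trans (∏-zero _ v (≡.trans (cong (f v *_) (𝟙-false (P? v) ¬Pv)) (ℤ.*-zeroʳ (f v))))
            (sym (ℤ.*-zeroʳ (∏ f)))

  cons : ∀ {d a} (C : Fin (suc d) → Set a) → C zero → (∀ v → C (suc v)) → ∀ v → C v
  cons C c f zero    = c
  cons C c f (suc v) = f v

  sections : ∀ {d a} {C : Fin d → Set a} → (∀ v → List (C v)) → List (∀ v → C v)
  sections {zero}  Cs = (λ ()) ∷ []
  sections {suc d} {C = C} Cs = cartesianProductWith (cons C) (Cs zero) (sections (Cs ∘ suc))

  -- Without function extensionality, a choice function is listed only up to
  -- pointwise equality.
  sections-complete : ∀ {d a} {C : Fin d → Set a} (Cs : ∀ v → List (C v)) (f : ∀ v → C v) →
    (∀ v → f v ∈ Cs v) → ∃ λ g → g ∈ sections Cs × (∀ v → g v ≡ f v)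
  sections-complete {zero}  Cs f f∈Cs = (λ ()) , here refl , λ ()
  sections-complete {suc d} {C = C} Cs f f∈Cs
    with g , g∈ , g≗f ← sections-complete (Cs ∘ suc) (f ∘ suc) (f∈Cs ∘ suc) =
    cons C (f zero) g , ∈-cartesianProductWith⁺ (cons C) (f∈Cs zero) g∈ , eq
    where
    eq : ∀ v → cons C (f zero) g v ≡ f v
    eq zero    = refl
    eq (suc v) = g≗f v

  -- Distributivity: expanding the product of sums picks one summand from each factor, and such a
  -- pick is a choice function.
  ∑-∏ : ∀ {d a} {C : Fin d → Set a} (Cs : ∀ v → List (C v)) (w : ∀ v → C v → ℤ) →
        ∑ (sections Cs) (λ f → ∏ (λ v → w v (f v))) ≡ ∏ (λ v → ∑ (Cs v) (w v))
  ∑-∏ {zero}  Cs w = refl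
  ∑-∏ {suc d} {C = C} Cs w = begin
    ∑ (sections Cs) (λ f → ∏ (λ v → w v (f v)))
      ≡⟨ ∑-cartesianProductWith (cons C) (Cs zero) (sections (Cs ∘ suc)) (λ f → ∏ (λ v → w v (f v))) ⟩
    ∑ (Cs zero) (λ c → ∑ (sections (Cs ∘ suc)) (λ f → w zero c * ∏ (λ v → w (suc v) (f v))))
      ≡⟨ ∑-cong (Cs zero) (λ c → ≡.trans (∑-*ˡ (sections (Cs ∘ suc)) (w zero c) _)
                                         (cong (w zero c *_) (∑-∏ (Cs ∘ suc) (w ∘ suc)))) ⟩
    ∑ (Cs zero) (λ c → w zero c * ∏ (λ v → ∑ (Cs (suc v)) (w (suc v))))
      ≡⟨ ∑-*ʳ (Cs zero) (w zero) _ ⟩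
    ∏ (λ v → ∑ (Cs v) (w v)) ∎
    where open ≡-Reasoning

  -- `nothing` will leave a vertex without an edge, and `just i` will pick its `i`-th edge to an
  -- earlier neighbour.
  options : ∀ k → List (Maybe (Fin k))
  options k = nothing ∷ map just (allFin k)

  ∈-options : ∀ {k} (c : Maybe (Fin k)) → c ∈ options k
  ∈-options nothing  = here refl
  ∈-options (just i) = there (∈-map⁺ just (∈-allFin i))

  ∑-options : ∀ k f → ∑ (options k) f ≡ f nothing + ∑ (allFin k) (f ∘ just)
  ∑-options k f = cong (_+_ (f nothing)) (∑-map (allFin k) just f)

  -- One factor -1 for each chosen edge, so that the product over the vertices is (-1)^∣F∣.
  sign : ∀ {a} {A : Set a} → Maybe A → ℤ
  sign nothing  = 1ℤ
  sign (just _) = -1ℤ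

  -- Enumeration of the positions where a Boolean function is true

  count : ∀ {d} → (Fin d → Bool) → ℕ
  count {zero}  b = 0
  count {suc d} b = if b zero then suc (count (b ∘ suc)) else count (b ∘ suc)

  count-cong : ∀ {d} {b b′ : Fin d → Bool} → (∀ v → b v ≡ b′ v) → count b ≡ count b′
  count-cong {zero}  eq = refl
  count-cong {suc d} eq rewrite eq zero | count-cong (eq ∘ suc) = refl

  -- The increasing enumeration of the positions where `b` is true; it will number the roots of a
  -- forest.
  select : ∀ {d} (b : Fin d → Bool) → Fin (count b) → Fin d
  select {suc d} b i with b zero
  select {suc d} b zero    | true  = zero
  select {suc d} b (suc i) | true  = suc (select (b ∘ suc) i)
  select {suc d} b i       | false = suc (select (b ∘ suc) i)

  select-true : ∀ {d} (b : Fin d → Bool) i → b (select b i) ≡ true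
  select-true {suc d} b i with b zero in eq
  select-true {suc d} b zero    | true  = eq
  select-true {suc d} b (suc i) | true  = select-true (b ∘ suc) i
  select-true {suc d} b i       | false = select-true (b ∘ suc) i

  select-injective : ∀ {d} (b : Fin d → Bool) {i j} → select b i ≡ select b j → i ≡ j
  select-injective {suc d} b {i} {j} eq with b zero
  select-injective {suc d} b {zero}  {zero}  eq | true  = refl
  select-injective {suc d} b {suc i} {suc j} eq | true  =
    cong suc (select-injective (b ∘ suc) (Fin.suc-injective eq))
  select-injective {suc d} b {i}     {j}     eq | false =
    select-injective (b ∘ suc) (Fin.suc-injective eq)

  select-surjective : ∀ {d} (b : Fin d → Bool) v → b v ≡ true → ∃ λ i → select b i ≡ v
  select-surjective {suc d} b zero    bv with b zero
  select-surjective {suc d} b zero    bv | true = zero , refl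
  select-surjective {suc d} b (suc v) bv with i , eq ← select-surjective (b ∘ suc) v bv | b zero
  ... | true  = suc i , cong suc eq
  ... | false = i , cong suc eq

  -- Polynomials

  -- The Kronecker delta, in the role of the coefficient of t^k in t^j.
  δ : ℕ → ℕ → ℤ
  δ zero    zero    = 1ℤ
  δ zero    (suc k) = 0ℤ
  δ (suc j) zero    = 0ℤ
  δ (suc j) (suc k) = δ j k

  coeff-monomial : ∀ a j k → coeff (monomial a j) k ≡ a * δ j k
  coeff-monomial a zero    zero    = sym (ℤ.*-identityʳ a)
  coeff-monomial a zero    (suc k) = sym (ℤ.*-zeroʳ a)
  coeff-monomial a (suc j) zero    = sym (ℤ.*-zeroʳ a)
  coeff-monomial a (suc j) (suc k) = coeff-monomial a j k

  coeff-+ₚ : ∀ p q k → coeff (p +ₚ q) k ≡ coeff p k + coeff q k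
  coeff-+ₚ []      q       k       = sym (ℤ.+-identityˡ _)
  coeff-+ₚ (a ∷ p) []      k       = sym (ℤ.+-identityʳ _)
  coeff-+ₚ (a ∷ p) (b ∷ q) zero    = refl
  coeff-+ₚ (a ∷ p) (b ∷ q) (suc k) = coeff-+ₚ p q k

  coeff-∑ₚ : ∀ {a} {A : Set a} (xs : List A) f k →
             coeff (∑ₚ (map f xs)) k ≡ ∑ xs (λ x → coeff (f x) k)
  coeff-∑ₚ []       f k = refl
  coeff-∑ₚ (x ∷ xs) f k = ≡.trans (coeff-+ₚ (f x) _ k) (cong (_+_ (coeff (f x) k)) (coeff-∑ₚ xs f k))

  coeff-scale : ∀ a q k → coeff (map (a *_) q) k ≡ a * coeff q k
  coeff-scale a []      k       = sym (ℤ.*-zeroʳ a)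
  coeff-scale a (b ∷ q) zero    = refl
  coeff-scale a (b ∷ q) (suc k) = coeff-scale a q k

  coeff-∷*-zero : ∀ a p q → coeff ((a ∷ p) *ₚ q) 0 ≡ a * coeff q 0
  coeff-∷*-zero a p q = ≡.trans (coeff-+ₚ (map (a *_) q) _ 0)
    (≡.trans (ℤ.+-identityʳ _) (coeff-scale a q 0))

  coeff-∷*-suc : ∀ a p q k → coeff ((a ∷ p) *ₚ q) (suc k) ≡ a * coeff q (suc k) + coeff (p *ₚ q) k
  coeff-∷*-suc a p q k = ≡.trans (coeff-+ₚ (map (a *_) q) _ (suc k))
    (cong (_+ _) (coeff-scale a q (suc k)))

  coeff-const* : ∀ a q k → coeff ((a ∷ []) *ₚ q) k ≡ a * coeff q k
  coeff-const* a q zero    = coeff-∷*-zero a [] q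
  coeff-const* a q (suc k) = ≡.trans (coeff-∷*-suc a [] q k) (ℤ.+-identityʳ _)

  coeff-t-*-suc : ∀ i q k → coeff ((t- i) *ₚ q) (suc k) ≡ - (+ i) * coeff q (suc k) + coeff q k
  coeff-t-*-suc i q k = ≡.trans (coeff-∷*-suc (- (+ i)) (1ℤ ∷ []) q k)
    (cong (_+_ (- (+ i) * coeff q (suc k))) (≡.trans (coeff-const* 1ℤ q k) (ℤ.*-identityˡ _)))

  -- Indexed by a list, so that the factors can be reordered along `_↭_`.
  linearFactors : List ℕ → ℤ[t]
  linearFactors = foldr (λ i q → (t- i) *ₚ q) 1ₚ

  ∑-allFin-const : ∀ k c → ∑ (allFin k) (λ _ → c) ≡ + k * c
  ∑-allFin-const k c = begin
    ∑ (allFin k) (λ _ → c)            ≡⟨ ∑-cong (allFin k) (λ _ → sym (ℤ.*-identityˡ c)) ⟩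
    ∑ (allFin k) (λ _ → 1ℤ * c)       ≡⟨ ∑-*ʳ (allFin k) (λ _ → 1ℤ) c ⟩
    ∑ (allFin k) (λ _ → 1ℤ) * c       ≡⟨ cong (_* c) (ones (allFin k)) ⟩
    + length (allFin k) * c           ≡⟨ cong (λ n → + n * c) (List.length-tabulate {n = k} (λ i → i)) ⟩
    + k * c                           ∎
    where
    open ≡-Reasoning
    ones : ∀ {n} (is : List (Fin n)) → ∑ is (λ _ → 1ℤ) ≡ + length is
    ones []       = refl
    ones (i ∷ is) = cong (_+_ 1ℤ) (ones is)

  -- Induction on the number of vertices. Leaving the first vertex without an edge raises the
  -- exponent by one, which gives a factor t; each of its `deg zero` edges gives a factor -1.
  -- Together these make up `t- deg zero`.
  ∑-options-linear : ∀ {d} (deg : Fin d → ℕ) k →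
    ∑ (sections (options ∘ deg)) (λ F → ∏ (sign ∘ F) * δ (count (is-nothing ∘ F)) k) ≡
    coeff (linearFactors (tabulate deg)) k
  ∑-options-linear {zero}  deg zero    = refl
  ∑-options-linear {zero}  deg (suc k) = refl
  ∑-options-linear {suc d} deg k       = begin
    ∑ (sections (options ∘ deg)) (λ F → ∏ (sign ∘ F) * δ (count (is-nothing ∘ F)) k)
      ≡⟨ ∑-cartesianProductWith (cons C) (options (deg zero)) Fs
           (λ F → ∏ (sign ∘ F) * δ (count (is-nothing ∘ F)) k) ⟩
    ∑ (options (deg zero)) term
      ≡⟨ ∑-options (deg zero) term ⟩
    ∑ Fs (λ F → 1ℤ * s F * δ (suc (r F)) k) +
    ∑ (allFin (deg zero)) (λ _ → ∑ Fs (λ F → -1ℤ * s F * δ (r F) k))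
      ≡⟨ cong₂ _+_ (∑-cong Fs λ F → cong (_* δ (suc (r F)) k) (ℤ.*-identityˡ (s F)))
                   (∑-allFin-const (deg zero) _) ⟩
    ∑ Fs (λ F → s F * δ (suc (r F)) k) + + deg zero * ∑ Fs (λ F → -1ℤ * s F * δ (r F) k)
      ≡⟨ cong (λ x → total + + deg zero * x)
           (≡.trans (∑-cong Fs λ F → ℤ.*-assoc -1ℤ (s F) (δ (r F) k)) (∑-*ˡ Fs -1ℤ _)) ⟩
    ∑ Fs (λ F → s F * δ (suc (r F)) k) + + deg zero * (-1ℤ * ∑ Fs (λ F → s F * δ (r F) k))
      ≡⟨ cong (λ x → total + + deg zero * (-1ℤ * x)) (∑-options-linear (deg ∘ suc) k) ⟩
    ∑ Fs (λ F → s F * δ (suc (r F)) k) + + deg zero * (-1ℤ * coeff Q k)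
      ≡⟨ shifted k ⟩
    coeff ((t- deg zero) *ₚ Q) k ∎
    where
    open ≡-Reasoning
    C : Fin (suc d) → Set
    C v = Maybe (Fin (deg v))
    Fs = sections (options ∘ deg ∘ suc)
    s : (∀ v → Maybe (Fin (deg (suc v)))) → ℤ
    s F = ∏ (sign ∘ F)
    r : (∀ v → Maybe (Fin (deg (suc v)))) → ℕ
    r F = count (is-nothing ∘ F)
    Q = linearFactors (tabulate (deg ∘ suc))
    term : Maybe (Fin (deg zero)) → ℤ
    term c = ∑ Fs (λ F → sign c * s F * δ (count (is-nothing ∘ cons C c F)) k)
    total = ∑ Fs (λ F → s F * δ (suc (r F)) k)

    rearrange₀ : ∀ m q → 0ℤ + m * (-1ℤ * q) ≡ - m * q
    rearrange₀ = solve-∀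
    rearrange₁ : ∀ m q q′ → q′ + m * (-1ℤ * q) ≡ - m * q + q′
    rearrange₁ = solve-∀

    shifted : ∀ k → ∑ Fs (λ F → s F * δ (suc (r F)) k) + + deg zero * (-1ℤ * coeff Q k) ≡
                    coeff ((t- deg zero) *ₚ Q) k
    -- A raised exponent is never 0, so the first sum vanishes. At `suc k` it is the induction
    -- hypothesis at `k`.
    shifted zero = ≡.trans
      (≡.trans (cong (_+ + deg zero * (-1ℤ * coeff Q 0))
                 (≡.trans (∑-cong Fs λ F → ℤ.*-zeroʳ (s F)) (∑-0 Fs)))
               (rearrange₀ (+ deg zero) (coeff Q 0)))
      (sym (coeff-∷*-zero (- (+ deg zero)) (1ℤ ∷ []) Q))
    shifted (suc k) = ≡.trans
      (≡.trans (cong (_+ + deg zero * (-1ℤ * coeff Q (suc k))) (∑-options-linear (deg ∘ suc) k))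
               (rearrange₁ (+ deg zero) (coeff Q (suc k)) (coeff Q k)))
      (sym (coeff-t-*-suc (deg zero) Q k))

  *ₚ-congˡ : ∀ p q q′ → q ≈ₚ q′ → (p *ₚ q) ≈ₚ (p *ₚ q′)
  *ₚ-congˡ []      q q′ eq k       = refl
  *ₚ-congˡ (a ∷ p) q q′ eq zero =
    ≡.trans (coeff-∷*-zero a p q) (≡.trans (cong (a *_) (eq 0)) (sym (coeff-∷*-zero a p q′)))
  *ₚ-congˡ (a ∷ p) q q′ eq (suc k) =
    ≡.trans (coeff-∷*-suc a p q k)
      (≡.trans (cong₂ _+_ (cong (a *_) (eq (suc k))) (*ₚ-congˡ p q q′ eq k)) (sym (coeff-∷*-suc a p q′ k)))

  -- The coefficient at `k` involves those of `q` at `k`, `k − 1` and `k − 2`, as far as these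
  -- exist; hence the three cases.
  t-*-swap : ∀ i j q → ((t- i) *ₚ ((t- j) *ₚ q)) ≈ₚ ((t- j) *ₚ ((t- i) *ₚ q))
  t-*-swap i j q zero
    rewrite coeff-∷*-zero (- (+ i)) (1ℤ ∷ []) ((t- j) *ₚ q)
          | coeff-∷*-zero (- (+ j)) (1ℤ ∷ []) ((t- i) *ₚ q)
          | coeff-∷*-zero (- (+ i)) (1ℤ ∷ []) q
          | coeff-∷*-zero (- (+ j)) (1ℤ ∷ []) q = lemma (- (+ i)) (- (+ j)) (coeff q 0)
    where
    lemma : ∀ a b x → a * (b * x) ≡ b * (a * x)
    lemma = solve-∀
  t-*-swap i j q (suc zero)
    rewrite coeff-t-*-suc i ((t- j) *ₚ q) 0 | coeff-t-*-suc j ((t- i) *ₚ q) 0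
          | coeff-t-*-suc i q 0 | coeff-t-*-suc j q 0
          | coeff-∷*-zero (- (+ i)) (1ℤ ∷ []) q
          | coeff-∷*-zero (- (+ j)) (1ℤ ∷ []) q = lemma (- (+ i)) (- (+ j)) (coeff q 0) (coeff q 1)
    where
    lemma : ∀ a b x y → a * (b * y + x) + b * x ≡ b * (a * y + x) + a * x
    lemma = solve-∀
  t-*-swap i j q (suc (suc k))
    rewrite coeff-t-*-suc i ((t- j) *ₚ q) (suc k) | coeff-t-*-suc j ((t- i) *ₚ q) (suc k)
          | coeff-t-*-suc i q (suc k) | coeff-t-*-suc j q (suc k)
          | coeff-t-*-suc i q k | coeff-t-*-suc j q k =
    lemma (- (+ i)) (- (+ j)) (coeff q k) (coeff q (suc k)) (coeff q (suc (suc k)))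
    where
    lemma : ∀ a b x y z → a * (b * z + y) + (b * y + x) ≡ b * (a * z + y) + (a * y + x)
    lemma = solve-∀

  linearFactors-↭ : ∀ {is js} → is ↭ js → linearFactors is ≈ₚ linearFactors js
  linearFactors-↭ refl k = refl
  linearFactors-↭ {i ∷ is} {_ ∷ js} (prep i p) =
    *ₚ-congˡ (t- i) (linearFactors is) (linearFactors js) (linearFactors-↭ p)
  linearFactors-↭ {_ ∷ _ ∷ is} {_ ∷ _ ∷ js} (swap i j p) k = ≡.trans
    (*ₚ-congˡ (t- i) (linearFactors (j ∷ is)) (linearFactors (j ∷ js))
      (*ₚ-congˡ (t- j) (linearFactors is) (linearFactors js) (linearFactors-↭ p)) k)
    (t-*-swap i j (linearFactors js) k)
  linearFactors-↭ (trans p q) k = ≡.trans (linearFactors-↭ p k) (linearFactors-↭ q k)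

  *ₚ-distribʳ-+ₚ : ∀ q p p′ → ((p +ₚ p′) *ₚ q) ≈ₚ (p *ₚ q +ₚ p′ *ₚ q)
  *ₚ-distribʳ-+ₚ q []      p′       k    = refl
  *ₚ-distribʳ-+ₚ q (a ∷ p) []       k    =
    sym (≡.trans (coeff-+ₚ ((a ∷ p) *ₚ q) [] k) (ℤ.+-identityʳ _))
  *ₚ-distribʳ-+ₚ q (a ∷ p) (b ∷ p′) zero
    rewrite coeff-∷*-zero (a + b) (p +ₚ p′) q
          | coeff-+ₚ ((a ∷ p) *ₚ q) ((b ∷ p′) *ₚ q) 0
          | coeff-∷*-zero a p q | coeff-∷*-zero b p′ q = ℤ.*-distribʳ-+ (coeff q 0) a b
  *ₚ-distribʳ-+ₚ q (a ∷ p) (b ∷ p′) (suc k)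
    rewrite coeff-∷*-suc (a + b) (p +ₚ p′) q k
          | coeff-+ₚ ((a ∷ p) *ₚ q) ((b ∷ p′) *ₚ q) (suc k)
          | coeff-∷*-suc a p q k | coeff-∷*-suc b p′ q k
          | *ₚ-distribʳ-+ₚ q p p′ k | coeff-+ₚ (p *ₚ q) (p′ *ₚ q) k =
    lemma a b (coeff q (suc k)) (coeff (p *ₚ q) k) (coeff (p′ *ₚ q) k)
    where
    lemma : ∀ a b x y z → (a + b) * x + (y + z) ≡ (a * x + y) + (b * x + z)
    lemma = solve-∀

  *ₚ-scaleˡ : ∀ a p q k → coeff (map (a *_) p *ₚ q) k ≡ a * coeff (p *ₚ q) k
  *ₚ-scaleˡ a []      q k    = sym (ℤ.*-zeroʳ a)
  *ₚ-scaleˡ a (b ∷ p) q zero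
    rewrite coeff-∷*-zero (a * b) (map (a *_) p) q | coeff-∷*-zero b p q = ℤ.*-assoc a b _
  *ₚ-scaleˡ a (b ∷ p) q (suc k)
    rewrite coeff-∷*-suc (a * b) (map (a *_) p) q k | coeff-∷*-suc b p q k | *ₚ-scaleˡ a p q k =
    lemma a b (coeff q (suc k)) (coeff (p *ₚ q) k)
    where
    lemma : ∀ a b x y → a * b * x + a * y ≡ a * (b * x + y)
    lemma = solve-∀

  -- Multiplication by `a ∷ p` splits into scaling by `a` and a shifted product with `p`. Scaling
  -- passes through the product with `r`, and induction handles the shifted part.
  *ₚ-assoc : ∀ p q r → (p *ₚ q *ₚ r) ≈ₚ (p *ₚ (q *ₚ r))
  *ₚ-assoc []      q r k = refl
  *ₚ-assoc (a ∷ p) q r k = ≡.trans (*ₚ-distribʳ-+ₚ r (map (a *_) q) _ k)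
    (≡.trans (coeff-+ₚ (map (a *_) q *ₚ r) _ k) (step k))
    where
    step : ∀ k → coeff (map (a *_) q *ₚ r) k + coeff ((0ℤ ∷ (p *ₚ q)) *ₚ r) k ≡
                 coeff ((a ∷ p) *ₚ (q *ₚ r)) k
    step zero
      rewrite coeff-∷*-zero a p (q *ₚ r) | coeff-∷*-zero 0ℤ (p *ₚ q) r | *ₚ-scaleˡ a q r 0 =
      ℤ.+-identityʳ _
    step (suc k)
      rewrite coeff-∷*-suc a p (q *ₚ r) k | coeff-∷*-suc 0ℤ (p *ₚ q) r k
            | *ₚ-scaleˡ a q r (suc k) | *ₚ-assoc p q r k =
      cong (_+_ (a * coeff (q *ₚ r) (suc k))) (ℤ.+-identityˡ _)

  *ₚ-identityˡ : ∀ q → (1ₚ *ₚ q) ≈ₚ q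
  *ₚ-identityˡ q k = ≡.trans (coeff-const* 1ℤ q k) (ℤ.*-identityˡ _)

  -- `p ^ₚ 2` computes to `p *ₚ (p *ₚ 1ₚ)`; unnesting it yields two successive entries of a list of
  -- linear factors.
  ^ₚ2-* : ∀ p q → (p ^ₚ 2 *ₚ q) ≈ₚ (p *ₚ (p *ₚ q))
  ^ₚ2-* p q k = ≡.trans (*ₚ-assoc p (p *ₚ 1ₚ) q k)
    (*ₚ-congˡ p (p *ₚ 1ₚ *ₚ q) (p *ₚ q) (λ k′ →
      ≡.trans (*ₚ-assoc p 1ₚ q k′) (*ₚ-congˡ p (1ₚ *ₚ q) q (*ₚ-identityˡ q) k′)) k)

open IntegerSums

-- Graphic arrangements of chordal graphs

lookup-injective : ∀ {a} {A : Set a} {xs : List A} → Unique xs →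
                   ∀ {i j} → lookup xs i ≡ lookup xs j → i ≡ j
lookup-injective (_ ∷ _)    {zero}  {zero}  eq = refl
lookup-injective (x∉xs ∷ _) {zero}  {suc j} eq = contradiction eq (All.lookup x∉xs (∈-lookup j))
lookup-injective (x∉xs ∷ _) {suc i} {zero}  eq = contradiction (sym eq) (All.lookup x∉xs (∈-lookup i))
lookup-injective (_ ∷ xs!)  {suc i} {suc j} eq = cong suc (lookup-injective xs! eq)

-- A graph with a perfect elimination ordering, given by a rank function: the
-- neighbours of lower rank of each vertex form a clique.
record ChordalGraph (d : ℕ) : Set where
  field
    earlier : Fin d → List (Fin d)
    unique  : ∀ v → Unique (earlier v)
    rank    : Fin d → ℕ
    rank-<  : ∀ {v w} → w ∈ earlier v → rank w < rank v
    clique  : ∀ {u v w} → u ∈ earlier v → w ∈ earlier v → u ≢ w → u ∈ earlier w ⊎ w ∈ earlier u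

  deg : Fin d → ℕ
  deg v = length (earlier v)

  nb : ∀ v → Fin (deg v) → Fin d
  nb v = lookup (earlier v)

  nb-∈ : ∀ v i → nb v i ∈ earlier v
  nb-∈ v = ∈-lookup

  nb-surjective : ∀ {v w} → w ∈ earlier v → ∃ λ i → nb v i ≡ w
  nb-surjective w∈ = Any.index w∈ , sym (Any.lookup-index w∈)

  -- Each vertex has at most one chosen edge towards lower rank, so the chosen edges close no cycle.
  Forest : Set
  Forest = ∀ v → Maybe (Fin (deg v))

  forests : List Forest
  forests = sections (λ v → options (deg v))

  -- The path from a vertex to the root of its tree, as a relation, so that proofs can proceed by
  -- induction on the path instead of on accessibility.
  data Root (F : Forest) : Fin d → Fin d → Set where
    stop : ∀ {v} → F v ≡ nothing → Root F v v
    step : ∀ {v i r} → F v ≡ just i → Root F (nb v i) r → Root F v r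

  Root-total : ∀ F v → ∃ (Root F v)
  Root-total F v = go v (<-wellFounded (rank v))
    where
    go : ∀ v → Acc _<_ (rank v) → ∃ (Root F v)
    go v (acc rs) with F v in eq
    ... | nothing = v , stop eq
    ... | just i with r , p ← go (nb v i) (rs (rank-< (nb-∈ v i))) = r , step eq p

  -- Yields the unfolding equations `root-stop` and `root-step` without computing the well-founded
  -- recursion behind `root`.
  Root-functional : ∀ {F v r s} → Root F v r → Root F v s → r ≡ s
  Root-functional (stop _)   (stop _)    = refl
  Root-functional (stop p)   (step q _)  with () ← ≡.trans (sym p) q
  Root-functional (step p _) (stop q)    with () ← ≡.trans (sym p) q
  Root-functional (step p r) (step q s)  with refl ← ≡.trans (sym p) q = Root-functional r s

  Root-end : ∀ {F v r} → Root F v r → F r ≡ nothing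
  Root-end (stop p)   = p
  Root-end (step _ r) = Root-end r

  Root-rank : ∀ {F v r} → Root F v r → rank r ≤ rank v
  Root-rank (stop _)                   = ℕ.≤-refl
  Root-rank (step {v = v} {i = i} _ r) = ℕ.≤-trans (Root-rank r) (ℕ.<⇒≤ (rank-< (nb-∈ v i)))

  root : Forest → Fin d → Fin d
  root F v = proj₁ (Root-total F v)

  Root-root : ∀ F v → Root F v (root F v)
  Root-root F v = proj₂ (Root-total F v)

  root-stop : ∀ F {v} → F v ≡ nothing → root F v ≡ v
  root-stop F eq = Root-functional (Root-root F _) (stop eq)

  root-step : ∀ F {v i} → F v ≡ just i → root F v ≡ root F (nb v i)
  root-step F eq = Root-functional (Root-root F _) (step eq (Root-root F _))

module GraphicArrangements {c ℓ₁ ℓ₂} (K : HeytingField c ℓ₁ ℓ₂) where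
  open HeytingField K using (_≈_; 0#; 1#; Carrier; #-irrefl; setoid; _*_; _+_; +-identityˡ)
    renaming (refl to ≈-refl; sym to ≈-sym; trans to ≈-trans)
  open HeytingCommutativeRing (HeytingField.heytingCommutativeRing K) using (commutativeRing)
  open HeytingProperties (HeytingField.heytingCommutativeRing K) using (1#0)
  open CommutativeRing commutativeRing using (semiring; +-cong; *-congˡ; zeroʳ; *-identityʳ; +-identityʳ)
  open SemiringSum semiring using (sum; sum-cong-≋; sum-replicate-zero)
  open Arrangements K

  -- Coordinate vectors

  coordinate-same : ∀ {d} (i : Fin d) → coordinate i i ≡ 1#
  coordinate-same i = cong (if_then 1# else 0#) (dec-true (i Fin.≟ i) refl)

  coordinate-other : ∀ {d} {i k : Fin d} → i ≢ k → coordinate i k ≡ 0#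
  coordinate-other {i = i} {k} i≢k = cong (if_then 1# else 0#) (dec-false (i Fin.≟ k) i≢k)

  coordinate-suc : ∀ {d} (i k : Fin d) → coordinate (suc i) (suc k) ≡ coordinate i k
  coordinate-suc i k with i Fin.≟ k
  ... | yes _ = refl
  ... | no  _ = refl

  sum-coordinate : ∀ {d} (a : Vector Carrier d) i → sum (λ k → a k * coordinate i k) ≈ a i
  sum-coordinate {suc d} a zero = begin
    a zero * 1# + sum (λ k → a (suc k) * 0#)
      ≈⟨ +-cong (*-identityʳ (a zero)) (sum-cong-≋ {d} {λ k → a (suc k) * 0#} {λ _ → 0#} λ k → zeroʳ _) ⟩
    a zero + sum {d} (λ _ → 0#)  ≈⟨ +-cong ≈-refl (sum-replicate-zero d) ⟩
    a zero + 0#                  ≈⟨ +-identityʳ _ ⟩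
    a zero                       ∎
    where open ≈-Reasoning setoid
  sum-coordinate {suc d} a (suc i) = begin
    a zero * 0# + sum (λ k → a (suc k) * coordinate (suc i) (suc k))
      ≈⟨ +-cong (zeroʳ (a zero))
           (sum-cong-≋ {d} {λ k → a (suc k) * coordinate (suc i) (suc k)} {λ k → a (suc k) * coordinate i k}
             λ k → *-congˡ (HeytingField.reflexive K (coordinate-suc i k))) ⟩
    0# + sum (λ k → a (suc k) * coordinate i k)  ≈⟨ +-identityˡ _ ⟩
    sum (λ k → a (suc k) * coordinate i k)       ≈⟨ sum-coordinate (a ∘ suc) i ⟩
    a (suc i)                                    ∎
    where open ≈-Reasoning setoid

  -- τ is a linear involution that turns the hyperplanes of A into the
  -- hyperplanes x v ≈ x w, for the edges v w of G.
  record IsGraphic {d} (G : ChordalGraph d) (A : Arrangement d) : Set (c ⊔ ℓ₁ ⊔ ℓ₂) where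
    open ChordalGraph G
    field
      τ               : Point d → Point d
      τ-cong          : ∀ {p q} → (∀ j → p j ≈ q j) → ∀ j → τ p j ≈ τ q j
      τ-involutive    : ∀ p j → τ (τ p) j ≈ p j
      τ-combination   : ∀ {k} (a : Vector Carrier k) v j →
                        τ (combination a v) j ≈ combination a (τ ∘ v) j
      edge⇒hyperplane : ∀ {v w} → w ∈ earlier v →
                        ∃ λ H → H ∈ A × (∀ p → p liesOn H ⇔ τ p v ≈ τ p w)
      hyperplane⇒edge : ∀ {H} → H ∈ A →
                        ∃₂ λ v w → w ∈ earlier v × (∀ p → p liesOn H ⇔ τ p v ≈ τ p w)

  module CharacteristicPolynomial {d} {G : ChordalGraph d} {A : Arrangement d}
                                  (graphic : IsGraphic G A) where
    open ChordalGraph G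
    open IsGraphic graphic
    open Flat
    open Poset (𝓛 A) using () renaming (_≤_ to _⊑_; _≈_ to _≋_)
    module 𝓛 = Poset (𝓛 A)

    -- The blocks of a flat, and decidability of the order

    V : Set
    V = Fin d

    infix 4 _⊢_~_
    -- A flat of a graphic arrangement amounts to a partition of the vertices; this relation holds
    -- when `v` and `w` share a block.
    _⊢_~_ : Flat A → V → V → Set (c ⊔ ℓ₁ ⊔ ℓ₂)
    X ⊢ v ~ w = ∀ p → ⟦ A ⟧ X p → τ p v ≈ τ p w

    ⊢-mono : ∀ {X Y} → X ⊑ Y → ∀ {v w} → X ⊢ v ~ w → Y ⊢ v ~ w
    ⊢-mono X⊑Y v~w p p∈Y = v~w p (X⊑Y p p∈Y)

    -- Points of X with arbitrary values on the fibres of f separate them.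
    ⊢⇒≡ : ∀ X {f : V → V} → (∀ g → ⟦ A ⟧ X (τ (g ∘ f))) → ∀ {v w} → X ⊢ v ~ w → f v ≡ f w
    ⊢⇒≡ X {f} points {v} {w} v~w with f v Fin.≟ f w
    ... | yes eq = eq
    ... | no neq = contradiction 1#0 (#-irrefl 1≈0)
      where
      open ≈-Reasoning setoid
      g : V → Carrier
      g = coordinate (f v)
      1≈0 : 1# ≈ 0#
      1≈0 = begin
        1#                   ≡⟨ coordinate-same (f v) ⟨
        g (f v)              ≈⟨ τ-involutive (g ∘ f) v ⟨
        τ (τ (g ∘ f)) v      ≈⟨ v~w _ (points g) ⟩
        τ (τ (g ∘ f)) w      ≈⟨ τ-involutive (g ∘ f) w ⟩
        g (f w)              ≡⟨ coordinate-other neq ⟩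
        0#                   ∎

    -- A name for the block of each vertex. By `sound`, vertices with the same label are joined; by
    -- `points`, values on labels can be prescribed freely, so different labels are not joined.
    record Labelling (Hs : List (Hyperplane d)) : Set (c ⊔ ℓ₁ ⊔ ℓ₂) where
      field
        label  : V → V
        sound  : ∀ p → ⋂ Hs p → ∀ v → τ p v ≈ τ p (label v)
        points : ∀ g → ⋂ Hs (τ (g ∘ label))

    -- Each hyperplane identifies two vertices `a` and `b`; their blocks are united by renaming the
    -- label of `a` to that of `b`.
    labelling : ∀ Hs → Hs ⊆ A → Labelling Hs
    labelling []       Hs⊆A = record { label = λ v → v ; sound = λ _ _ _ → ≈-refl ; points = λ _ → [] }
    labelling (H ∷ Hs) Hs⊆A
      with a , b , _ , lies ← hyperplane⇒edge (Hs⊆A (here refl))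
         | record { label = ℓ ; sound = sound ; points = points } ← labelling Hs (Hs⊆A ∘ there) =
      record
      { label  = λ v → merge (ℓ v)
      ; sound  = λ { p (p∈H ∷ p∈Hs) v → ≈-trans (sound p p∈Hs v) (merge-sound p p∈H p∈Hs (ℓ v)) }
      -- A function of the merged labels is in particular the function `g ∘ merge` of the old ones.
      ; points = λ g → Equivalence.from (lies _) (joined g) ∷ points (g ∘ merge)
      }
      where
      merge : V → V
      merge s = if does (s Fin.≟ ℓ a) then ℓ b else s
      merge-sound : ∀ p → p liesOn H → ⋂ Hs p → ∀ s → τ p s ≈ τ p (merge s)
      merge-sound p p∈H p∈Hs s with s Fin.≟ ℓ a
      ... | no  _    = ≈-refl
      ... | yes refl = ≈-trans (≈-sym (sound p p∈Hs a))
                         (≈-trans (Equivalence.to (lies p) p∈H) (sound p p∈Hs b))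
      merge-joined : merge (ℓ a) ≡ merge (ℓ b)
      merge-joined rewrite dec-true (ℓ a Fin.≟ ℓ a) refl with ℓ b Fin.≟ ℓ a
      ... | yes _ = refl
      ... | no  _ = refl
      joined : ∀ g → τ (τ (g ∘ merge ∘ ℓ)) a ≈ τ (τ (g ∘ merge ∘ ℓ)) b
      joined g = ≈-trans (τ-involutive _ a)
        (≈-trans (HeytingField.reflexive K (cong g merge-joined)) (≈-sym (τ-involutive _ b)))

    -- Equality in the field need not be decidable; labels in `Fin d` are compared instead.
    _⊢_~?_ : ∀ X v w → Dec (X ⊢ v ~ w)
    X ⊢ v ~? w with record { label = ℓ ; sound = sound ; points = points } ←
                    labelling (hyperplanes X) (⊆A X) =
      map′ (λ eq p p∈X → ≈-trans (sound p p∈X v) (≈-trans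
              (HeytingField.reflexive K (cong (τ p) eq)) (≈-sym (sound p p∈X w))))
           (⊢⇒≡ X points) (ℓ v Fin.≟ ℓ w)

    -- Each hyperplane that defines `X` comes from an edge, so the order can be tested on the
    -- finitely many edges.
    ⊑-intro : ∀ X Y → (∀ v i → X ⊢ v ~ nb v i → Y ⊢ v ~ nb v i) → X ⊑ Y
    ⊑-intro X Y imp p p∈Y = All.tabulate λ {H} H∈X →
      let v , w , w∈ , lies = hyperplane⇒edge (⊆A X H∈X)
          i , eq = nb-surjective w∈
          X⊢ = λ q q∈X → subst (λ w → τ q v ≈ τ q w) (sym eq)
                 (Equivalence.to (lies q) (All.lookup q∈X H∈X))
      in Equivalence.from (lies p) (subst (λ w → τ p v ≈ τ p w) eq (imp v i X⊢ p p∈Y))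

    _⊑?_ : ∀ X Y → Dec (X ⊑ Y)
    X ⊑? Y = map′ (⊑-intro X Y) (λ X⊑Y v i → ⊢-mono {X} {Y} X⊑Y)
      (Fin.all? λ v → Fin.all? λ i → (X ⊢ v ~? nb v i) →-dec (Y ⊢ v ~? nb v i))

    _≋?_ : ∀ X Y → Dec (X ≋ Y)
    X ≋? Y = (Y ⊑? X) ×-dec (X ⊑? Y)

    𝓛-decSetoid : DecSetoid _ _
    𝓛-decSetoid = record
      { isDecEquivalence = record { isEquivalence = 𝓛.isEquivalence ; _≟_ = _≋?_ } }

    -- The flat of a forest

    edgeAt : ∀ v → Maybe (Fin (deg v)) → List (Hyperplane d)
    edgeAt v nothing  = []
    edgeAt v (just i) = proj₁ (edge⇒hyperplane (nb-∈ v i)) ∷ []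

    edgeAt-⊆A : ∀ v o → All (_∈ A) (edgeAt v o)
    edgeAt-⊆A v nothing  = []
    edgeAt-⊆A v (just i) = proj₁ (proj₂ (edge⇒hyperplane (nb-∈ v i))) ∷ []

    edgeAt-lies⁺ : ∀ v o p → (∀ i → o ≡ just i → τ p v ≈ τ p (nb v i)) → ⋂ (edgeAt v o) p
    edgeAt-lies⁺ v nothing  p joined = []
    edgeAt-lies⁺ v (just i) p joined =
      Equivalence.from (proj₂ (proj₂ (edge⇒hyperplane (nb-∈ v i))) p) (joined i refl) ∷ []

    edges : Forest → List (Hyperplane d)
    edges F = concat (tabulate λ v → edgeAt v (F v))

    edges-lies⁺ : ∀ F p → (∀ v i → F v ≡ just i → τ p v ≈ τ p (nb v i)) → ⋂ (edges F) p
    edges-lies⁺ F p joined = All.concat⁺ (All.tabulate⁺ λ v → edgeAt-lies⁺ v (F v) p (joined v))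

    φ : Forest → Flat A
    φ F = record
      { hyperplanes = edges F
      ; ⊆A          = All.lookup (All.concat⁺ (All.tabulate⁺ λ v → edgeAt-⊆A v (F v)))
      -- Applying `τ` again gives back a constant function, which satisfies every edge equation.
      ; nonempty    = τ (λ _ → 0#) , edges-lies⁺ F _ λ v i _ →
                        ≈-trans (τ-involutive _ v) (≈-sym (τ-involutive _ (nb v i)))
      }

    φ-edge : ∀ F {v i} → F v ≡ just i → φ F ⊢ v ~ nb v i
    φ-edge F {v} {i} eq p p∈
      with p∈H ∷ [] ← subst (λ o → ⋂ (edgeAt v o) p) eq
                        (All.tabulate⁻ (All.concat⁻ {xss = tabulate λ u → edgeAt u (F u)} p∈) v) =
      Equivalence.to (proj₂ (proj₂ (edge⇒hyperplane (nb-∈ v i))) p) p∈H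

    φ-⊑ : ∀ F Y → (∀ v i → F v ≡ just i → Y ⊢ v ~ nb v i) → φ F ⊑ Y
    φ-⊑ F Y joined p p∈Y = edges-lies⁺ F p λ v i eq → joined v i eq p p∈Y

    Root⇒~ : ∀ {F v r} → Root F v r → φ F ⊢ v ~ r
    Root⇒~     (stop _)    p p∈ = ≈-refl
    Root⇒~ {F} (step eq r) p p∈ = ≈-trans (φ-edge F eq p p∈) (Root⇒~ r p p∈)

    -- A function of the root takes the same value at both ends of every chosen edge. These points
    -- separate different trees, as `φ-root` records.
    φ-points : ∀ F g → ⟦ A ⟧ (φ F) (τ (g ∘ root F))
    φ-points F g = edges-lies⁺ F _ λ v i eq → ≈-trans (τ-involutive _ v) (≈-trans
      (HeytingField.reflexive K (cong g (root-step F eq))) (≈-sym (τ-involutive _ (nb v i))))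

    φ-root : ∀ F {v w} → φ F ⊢ v ~ w → root F v ≡ root F w
    φ-root F = ⊢⇒≡ (φ F) (φ-points F)

    -- The canonical forest of a flat

    canonical : Flat A → Forest
    canonical X v with Fin.any? (λ i → X ⊢ v ~? nb v i)
    ... | yes (i , _) = just i
    ... | no _        = nothing

    canonical-just : ∀ X {v i} → canonical X v ≡ just i → X ⊢ v ~ nb v i
    canonical-just X {v} eq with Fin.any? (λ i → X ⊢ v ~? nb v i)
    canonical-just X {v} refl | yes (_ , v~i) = v~i

    canonical-nothing : ∀ X {v} → canonical X v ≡ nothing → ∀ i → ¬ (X ⊢ v ~ nb v i)
    canonical-nothing X {v} eq i v~i with Fin.any? (λ i → X ⊢ v ~? nb v i)
    canonical-nothing X {v} ()   i v~i | yes _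
    canonical-nothing X {v} refl i v~i | no ∄ = ∄ (i , v~i)

    φ-canonical-⊑ : ∀ X → φ (canonical X) ⊑ X
    φ-canonical-⊑ X = φ-⊑ (canonical X) X (λ v i → canonical-just X)

    -- Induction along the elimination order: if v is joined to w but its
    -- canonical edge goes to u, then u and w are adjacent.
    canonical-root : ∀ X {v w} → w ∈ earlier v → X ⊢ v ~ w →
                     root (canonical X) v ≡ root (canonical X) w
    canonical-root X {v} w∈ v~w = go _ (<-wellFounded (rank v)) w∈ v~w
      where
      F = canonical X
      go : ∀ v → Acc _<_ (rank v) → ∀ {w} → w ∈ earlier v → X ⊢ v ~ w → root F v ≡ root F w
      go v (acc rs) {w} w∈ v~w = cases (F v) refl
        where
        cases : ∀ o → F v ≡ o → root F v ≡ root F w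
        cases nothing  eq with i , refl ← nb-surjective w∈ =
          contradiction v~w (canonical-nothing X eq i)
        cases (just i) eq with nb v i Fin.≟ w
        ... | yes refl = root-step F eq
        ... | no u≢w = ≡.trans (root-step F eq) (joined (clique (nb-∈ v i) w∈ u≢w))
          where
          u~w : X ⊢ nb v i ~ w
          u~w p p∈X = ≈-trans (≈-sym (canonical-just X eq p p∈X)) (v~w p p∈X)
          joined : nb v i ∈ earlier w ⊎ w ∈ earlier (nb v i) → root F (nb v i) ≡ root F w
          joined (inj₁ u∈) = sym (go w (rs (rank-< w∈)) u∈ λ p p∈X → ≈-sym (u~w p p∈X))
          joined (inj₂ w∈) = go (nb v i) (rs (rank-< (nb-∈ v i))) w∈ u~w

    -- By `canonical-root`, the ends of an edge joined in `X` lie in one tree, along which all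
    -- coordinates agree.
    φ-canonical-⊒ : ∀ X → X ⊑ φ (canonical X)
    φ-canonical-⊒ X = ⊑-intro X (φ F) λ v i v~w p p∈ → begin
      τ p v                ≈⟨ Root⇒~ (Root-root F v) p p∈ ⟩
      τ p (root F v)       ≡⟨ cong (τ p) (canonical-root X (nb-∈ v i) v~w) ⟩
      τ p (root F (nb v i)) ≈⟨ Root⇒~ (Root-root F (nb v i)) p p∈ ⟨
      τ p (nb v i)         ∎
      where
      F = canonical X
      open ≈-Reasoning setoid

    -- Whether a vertex is joined in `X` to any earlier neighbour does not depend on which such
    -- neighbour a forest picks. Hence the number of roots is an invariant of the flat.
    is-nothing-canonical : ∀ X (F : Forest) → (∀ {v i} → F v ≡ just i → X ⊢ v ~ nb v i) →
      (∀ {v} → F v ≡ nothing → ∀ i → ¬ (X ⊢ v ~ nb v i)) →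
      ∀ v → is-nothing (canonical X v) ≡ is-nothing (F v)
    is-nothing-canonical X F F-just F-nothing v = cases (canonical X v) (F v) refl refl
      where
      cases : ∀ o o′ → canonical X v ≡ o → F v ≡ o′ → is-nothing o ≡ is-nothing o′
      cases nothing  nothing  _  _   = refl
      cases (just _) (just _) _  _   = refl
      cases nothing  (just i) eq eq′ = contradiction (F-just eq′) (canonical-nothing X eq i)
      cases (just i) nothing  eq eq′ = contradiction (canonical-just X eq) (F-nothing eq′ i)

    -- The dimension of a flat

    dim : Flat A → ℕ
    dim X = count (λ v → is-nothing (canonical X v))

    dim-cong : ∀ {X Y} → X ≋ Y → dim X ≡ dim Y
    dim-cong {X} {Y} (Y⊑X , X⊑Y) = count-cong (is-nothing-canonical X (canonical Y)
      (λ eq → ⊢-mono {Y} {X} Y⊑X (canonical-just Y eq))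
      (λ eq i X⊢ → canonical-nothing Y eq i (⊢-mono {X} {Y} X⊑Y X⊢)))

    -- A root `v` of `F` joined in `φ F` to an earlier neighbour would be the root of that neighbour
    -- too, although its rank is larger than that of the neighbour.
    dim-φ : ∀ F → dim (φ F) ≡ count (λ v → is-nothing (F v))
    dim-φ F = count-cong (is-nothing-canonical (φ F) F (φ-edge F) λ {v} eq i v~w →
      ℕ.<-irrefl (cong rank (≡.trans (sym (φ-root F v~w)) (root-stop F eq)))
                 (ℕ.≤-<-trans (Root-rank (Root-root F (nb v i))) (rank-< (nb-∈ v i))))

    -- The zero vector is the combination of no vectors.
    τ-zero : ∀ j → τ (λ _ → 0#) j ≈ 0#
    τ-zero = τ-combination {0} (λ ()) (λ ())

    -- The points `p` of `X` are those for which `τ p` is constant on each tree of the canonical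
    -- forest, so `X` passes through the origin. The basis consists of the images under `τ` of the
    -- indicator functions of the trees.
    hasDimension : ∀ X → HasDimension (⟦ A ⟧ X) (dim X)
    hasDimension X = (λ _ → 0#) , basis , independent , λ x → mk⇔ (spans x) (spanned x)
      where
      open ≈-Reasoning setoid
      F = canonical X
      isRoot = λ v → is-nothing (F v)

      nothing⇒isRoot : ∀ {v} → F v ≡ nothing → isRoot v ≡ true
      nothing⇒isRoot = cong is-nothing

      isRoot⇒nothing : ∀ {v} → isRoot v ≡ true → F v ≡ nothing
      isRoot⇒nothing {v} eq = cases (F v) eq
        where
        cases : ∀ (o : Maybe (Fin (deg v))) → is-nothing o ≡ true → o ≡ nothing
        cases nothing _ = refl

      rep : Fin (dim X) → V
      rep = select isRoot

      block : ∀ v → ∃ λ i → rep i ≡ root F v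
      block v = select-surjective isRoot (root F v) (nothing⇒isRoot (Root-end (Root-root F v)))

      -- The number of the tree that contains a vertex.
      ρ : V → Fin (dim X)
      ρ v = proj₁ (block v)

      ρ-rep : ∀ i → ρ (rep i) ≡ i
      ρ-rep i = select-injective isRoot
        (≡.trans (proj₂ (block (rep i))) (root-stop F (isRoot⇒nothing (select-true isRoot i))))

      ρ-cong : ∀ {v w} → root F v ≡ root F w → ρ v ≡ ρ w
      ρ-cong {v} {w} eq = select-injective isRoot
        (≡.trans (proj₂ (block v)) (≡.trans eq (sym (proj₂ (block w)))))

      basis : Fin (dim X) → Point d
      basis i = τ (λ v → coordinate (ρ v) i)

      τ-basis : ∀ a v → τ (combination a basis) v ≈ a (ρ v)
      τ-basis a v = begin
        τ (combination a basis) v                ≈⟨ τ-combination a basis v ⟩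
        sum (λ i → a i * τ (basis i) v)
          ≈⟨ sum-cong-≋ {dim X} {λ i → a i * τ (basis i) v} {λ i → a i * coordinate (ρ v) i}
               (λ i → *-congˡ (τ-involutive (λ v → coordinate (ρ v) i) v)) ⟩
        sum (λ i → a i * coordinate (ρ v) i)     ≈⟨ sum-coordinate a (ρ v) ⟩
        a (ρ v)                                  ∎

      independent : LinearlyIndependent basis
      independent a a≈0 i = begin
        a i                                  ≡⟨ cong a (ρ-rep i) ⟨
        a (ρ (rep i))                        ≈⟨ τ-basis a (rep i) ⟨
        τ (combination a basis) (rep i)      ≈⟨ τ-cong a≈0 (rep i) ⟩
        τ (λ _ → 0#) (rep i)                 ≈⟨ τ-zero (rep i) ⟩
        0#                                   ∎

      spans : ∀ x → ⟦ A ⟧ X x → ∃ λ a → ∀ j → x j ≈ 0# + combination a basis j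
      spans x x∈X = a , λ j → begin
        x j                                  ≈⟨ τ-involutive x j ⟨
        τ (τ x) j                            ≈⟨ τ-cong τx≈ j ⟩
        τ (τ (combination a basis)) j        ≈⟨ τ-involutive (combination a basis) j ⟩
        combination a basis j                ≈⟨ +-identityˡ _ ⟨
        0# + combination a basis j           ∎
        where
        a : Fin (dim X) → Carrier
        -- The value of `τ x` at the root is its value on the whole tree.
        a i = τ x (rep i)
        τx≈ : ∀ v → τ x v ≈ τ (combination a basis) v
        τx≈ v = begin
          τ x v                        ≈⟨ Root⇒~ (Root-root F v) x (φ-canonical-⊑ X x x∈X) ⟩
          τ x (root F v)               ≡⟨ cong (τ x) (proj₂ (block v)) ⟨
          a (ρ v)                      ≈⟨ τ-basis a v ⟨
          τ (combination a basis) v    ∎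

      spanned : ∀ x → (∃ λ a → ∀ j → x j ≈ 0# + combination a basis j) → ⟦ A ⟧ X x
      spanned x (a , x≈) = φ-canonical-⊒ X x (edges-lies⁺ F x λ v i eq → begin
        τ x v             ≈⟨ τx≈ v ⟩
        a (ρ v)           ≡⟨ cong a (ρ-cong (root-step F eq)) ⟩
        a (ρ (nb v i))    ≈⟨ τx≈ (nb v i) ⟨
        τ x (nb v i)      ∎)
        where
        τx≈ : ∀ v → τ x v ≈ a (ρ v)
        τx≈ v = ≈-trans (τ-cong (λ j → ≈-trans (x≈ j) (+-identityˡ _)) v) (τ-basis a v)

    -- The list of flats and sums over it

    flats : List (Flat A)
    flats = deduplicate _≋?_ (map φ forests)

    φ-cong : ∀ F F′ → (∀ v → F v ≡ F′ v) → φ F ⊑ φ F′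
    φ-cong F F′ F≗F′ = φ-⊑ F (φ F′) λ v i eq → φ-edge F′ (≡.trans (sym (F≗F′ v)) eq)

    flats-unique : SetoidUnique.Unique 𝓛.Eq.setoid flats
    flats-unique = DecSetoidUnique.deduplicate-! 𝓛-decSetoid (map φ forests)

    -- The canonical forest is listed only up to pointwise equality; `φ-cong` transfers its flat to
    -- the listed copy `F`.
    flats-complete : ∀ X → SetoidMembership._∈_ 𝓛.Eq.setoid X flats
    flats-complete X
      with F , F∈ , F≗ ← sections-complete (options ∘ deg) (canonical X)
                           (λ v → ∈-options (canonical X v)) =
      SetoidMembershipProperties.∈-deduplicate⁺ 𝓛.Eq.setoid _≋?_
        (λ {X} {Y} {Z} Z≋Y X≋Y → 𝓛.Eq.trans {X} {Y} {Z} X≋Y (𝓛.Eq.sym {Z} {Y} Z≋Y))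
        {z = X}
        (Any.map⁺ (Any.map (λ { refl → X≋φF }) F∈))
      where
      X≋φF : X ≋ φ F
      X≋φF = 𝓛.antisym {X} {φ F}
        (𝓛.trans {X} {φ (canonical X)} {φ F} (φ-canonical-⊒ X) (φ-cong (canonical X) F (sym ∘ F≗)))
        (𝓛.trans {φ F} {φ (canonical X)} {X} (φ-cong F (canonical X) F≗) (φ-canonical-⊑ X))

    weight : Forest → ℤ
    weight F = ∏ (λ v → sign (F v))

    μ : Flat A → ℤ
    μ X = ∑ forests (λ F → weight F ℤ.* 𝟙 (φ F ≋? X))

    μ-cong : ∀ {X Y} → X ≋ Y → μ X ≡ μ Y
    μ-cong {X} {Y} X≋Y = ∑-cong forests λ F → cong (weight F ℤ.*_)
      (𝟙-cong (φ F ≋? X) (φ F ≋? Y) (λ φ≋X → 𝓛.Eq.trans {φ F} {X} {Y} φ≋X X≋Y)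
        (λ φ≋Y → 𝓛.Eq.trans {φ F} {Y} {X} φ≋Y (𝓛.Eq.sym {X} {Y} X≋Y)))

    -- After exchanging the sums, each forest `F` meets exactly one listed flat, the one equal to
    -- `φ F`. This serves both the Möbius recursion and the characteristic polynomial.
    ∑-flats : (g : Flat A → ℤ) → (∀ {X Y} → X ≋ Y → g X ≡ g Y) →
              ∑ flats (λ X → μ X ℤ.* g X) ≡ ∑ forests (λ F → weight F ℤ.* g (φ F))
    ∑-flats g g-cong = begin
      ∑ flats (λ X → μ X ℤ.* g X)
        ≡⟨ ∑-cong flats (λ X → sym (∑-*ʳ forests (λ F → weight F ℤ.* 𝟙 (φ F ≋? X)) (g X))) ⟩
      ∑ flats (λ X → ∑ forests (λ F → weight F ℤ.* 𝟙 (φ F ≋? X) ℤ.* g X))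
        ≡⟨ ∑-swap flats forests (λ X F → weight F ℤ.* 𝟙 (φ F ≋? X) ℤ.* g X) ⟩
      ∑ forests (λ F → ∑ flats (λ X → weight F ℤ.* 𝟙 (φ F ≋? X) ℤ.* g X))
        ≡⟨ ∑-cong forests (λ F → ≡.trans
             (∑-cong flats (λ X → ℤ.*-assoc (weight F) (𝟙 (φ F ≋? X)) (g X)))
             (∑-*ˡ flats (weight F) (λ X → 𝟙 (φ F ≋? X) ℤ.* g X))) ⟩
      ∑ forests (λ F → weight F ℤ.* ∑ flats (λ X → 𝟙 (φ F ≋? X) ℤ.* g X))
        ≡⟨ ∑-cong forests (λ F → cong (weight F ℤ.*_)
             (∑-unique 𝓛-decSetoid g (λ {X} {Y} → g-cong {X} {Y}) flats-unique (flats-complete (φ F)))) ⟩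
      ∑ forests (λ F → weight F ℤ.* g (φ F)) ∎
      where open ≡-Reasoning

    -- The signed number of forests below a flat

    joined : Flat A → ∀ v → List (Fin (deg v))
    joined Y v = filter (λ i → Y ⊢ v ~? nb v i) (allFin (deg v))

    ∈-joined : ∀ Y {v i} → Y ⊢ v ~ nb v i → i ∈ joined Y v
    ∈-joined Y {v} {i} v~i = ∈-filter⁺ (λ i → Y ⊢ v ~? nb v i) (∈-allFin i) v~i

    joined-~ : ∀ Y {v i} → i ∈ joined Y v → Y ⊢ v ~ nb v i
    joined-~ Y {v} i∈ = proj₂ (∈-filter⁻ (λ i → Y ⊢ v ~? nb v i) {xs = allFin (deg v)} i∈)

    Within-flat : Flat A → ∀ v → Maybe (Fin (deg v)) → Set (c ⊔ ℓ₁ ⊔ ℓ₂)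
    Within-flat Y v nothing  = ⊤
    Within-flat Y v (just i) = Y ⊢ v ~ nb v i

    within? : ∀ Y v o → Dec (Within-flat Y v o)
    within? Y v nothing  = yes tt
    within? Y v (just i) = Y ⊢ v ~? nb v i

    φ-⊑? : ∀ (F : Forest) Y → Dec (∀ v → Within-flat Y v (F v))
    φ-⊑? F Y = Fin.all? (λ v → within? Y v (F v))

    φ-⊑⇒within : ∀ F Y → φ F ⊑ Y → ∀ v → Within-flat Y v (F v)
    φ-⊑⇒within F Y φ⊑Y v = cases (F v) refl
      where
      cases : ∀ o → F v ≡ o → Within-flat Y v o
      cases nothing  eq = tt
      cases (just i) eq = ⊢-mono {φ F} {Y} φ⊑Y (φ-edge F eq)

    within⇒φ-⊑ : ∀ F Y → (∀ v → Within-flat Y v (F v)) → φ F ⊑ Y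
    within⇒φ-⊑ F Y within = φ-⊑ F Y λ v i eq → subst (Within-flat Y v) eq (within v)

    -- The option of no edge contributes 1, and each edge at `v` whose ends `Y` joins contributes
    -- -1.
    factor : Flat A → V → ℤ
    factor Y v = 1ℤ ℤ.+ -1ℤ ℤ.* + length (joined Y v)

    ∑-options-within : ∀ Y v →
      ∑ (options (deg v)) (λ o → sign o ℤ.* 𝟙 (within? Y v o)) ≡ factor Y v
    ∑-options-within Y v = begin
      ∑ (options (deg v)) (λ o → sign o ℤ.* 𝟙 (within? Y v o))
        ≡⟨ ∑-options (deg v) (λ o → sign o ℤ.* 𝟙 (within? Y v o)) ⟩
      1ℤ ℤ.+ ∑ (allFin (deg v)) (λ i → -1ℤ ℤ.* 𝟙 (Y ⊢ v ~? nb v i))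
        ≡⟨ cong (ℤ._+_ 1ℤ) (∑-*ˡ (allFin (deg v)) -1ℤ (λ i → 𝟙 (Y ⊢ v ~? nb v i))) ⟩
      1ℤ ℤ.+ -1ℤ ℤ.* ∑ (allFin (deg v)) (λ i → 𝟙 (Y ⊢ v ~? nb v i))
        ≡⟨ cong (λ z → 1ℤ ℤ.+ -1ℤ ℤ.* z) (∑-𝟙 (λ i → Y ⊢ v ~? nb v i) (allFin (deg v))) ⟩
      factor Y v ∎
      where open ≡-Reasoning

    -- Whether `φ F ⊑ Y` holds can be checked at each vertex separately, so its indicator is a
    -- product over the vertices and `∑-∏` applies.
    ∑-forests-below : ∀ Y → ∑ forests (λ F → weight F ℤ.* 𝟙 (φ F ⊑? Y)) ≡ ∏ (factor Y)
    ∑-forests-below Y = begin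
      ∑ forests (λ F → weight F ℤ.* 𝟙 (φ F ⊑? Y))
        ≡⟨ ∑-cong forests (λ F → cong (weight F ℤ.*_)
             (𝟙-cong (φ F ⊑? Y) (φ-⊑? F Y) (φ-⊑⇒within F Y) (within⇒φ-⊑ F Y))) ⟩
      ∑ forests (λ F → weight F ℤ.* 𝟙 (φ-⊑? F Y))
        ≡⟨ ∑-cong forests (λ F → ∏-𝟙 (λ v → within? Y v (F v)) (φ-⊑? F Y) (λ v → sign (F v))) ⟨
      ∑ forests (λ F → ∏ (λ v → sign (F v) ℤ.* 𝟙 (within? Y v (F v))))
        ≡⟨ ∑-∏ (options ∘ deg) (λ v o → sign o ℤ.* 𝟙 (within? Y v o)) ⟩
      ∏ (λ v → ∑ (options (deg v)) (λ o → sign o ℤ.* 𝟙 (within? Y v o)))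
        ≡⟨ ∏-cong (∑-options-within Y) ⟩
      ∏ (factor Y) ∎
      where open ≡-Reasoning

    -- At a vertex of least rank that is joined in Y to an earlier neighbour,
    -- there is only one such neighbour, as two of them would be adjacent.
    sole-joined : ∀ Y {v i} → Y ⊢ v ~ nb v i → ∃ λ v → length (joined Y v) ≡ 1
    sole-joined Y {v} {i} v~i = go v (<-wellFounded (rank v)) i v~i
      where
      go : ∀ v → Acc _<_ (rank v) → ∀ i → Y ⊢ v ~ nb v i → ∃ λ v → length (joined Y v) ≡ 1
      go v (acc rs) i v~i =
        cases (joined Y v) refl (Unique.filter⁺ (λ i → Y ⊢ v ~? nb v i) (Unique.allFin⁺ (deg v)))
        where
        cases : ∀ is → joined Y v ≡ is → Unique is → ∃ λ v → length (joined Y v) ≡ 1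
        cases []          eq _ with () ← subst (i ∈_) eq (∈-joined Y v~i)
        cases (_ ∷ [])    eq _ = v , cong length eq
        cases (j ∷ k ∷ _) eq ((j≢k ∷ _) ∷ _) =
          descend (clique (nb-∈ v j) (nb-∈ v k) (j≢k ∘ lookup-injective (unique v)))
          where
          v~j = joined-~ Y (subst (j ∈_) (sym eq) (here refl))
          v~k = joined-~ Y (subst (k ∈_) (sym eq) (there (here refl)))
          descend : nb v j ∈ earlier (nb v k) ⊎ nb v k ∈ earlier (nb v j) →
                    ∃ λ v → length (joined Y v) ≡ 1
          descend (inj₁ j∈) with l , eq ← nb-surjective j∈ =
            go (nb v k) (rs (rank-< (nb-∈ v k))) l λ p p∈Y →
              ≈-trans (≈-sym (v~k p p∈Y)) (subst (λ u → τ p v ≈ τ p u) (sym eq) (v~j p p∈Y))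
          descend (inj₂ k∈) with l , eq ← nb-surjective k∈ =
            go (nb v j) (rs (rank-< (nb-∈ v j))) l λ p p∈Y →
              ≈-trans (≈-sym (v~j p p∈Y)) (subst (λ u → τ p v ≈ τ p u) (sym eq) (v~k p p∈Y))

    -- If `Y` joins the ends of some edge, `sole-joined` provides a factor 1 - 1. If it joins none,
    -- `⊑-intro` makes it the whole space.
    ∏-factor-zero : ∀ Y → ¬ (whole A ≋ Y) → ∏ (factor Y) ≡ 0ℤ
    ∏-factor-zero Y whole≉Y with Fin.any? (λ v → Fin.any? (λ i → Y ⊢ v ~? nb v i))
    ... | yes (_ , _ , v~i) with v , eq ← sole-joined Y v~i =
      ∏-zero (factor Y) v (cong (λ n → 1ℤ ℤ.+ -1ℤ ℤ.* + n) eq)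
    ... | no ∄ = contradiction
      (𝓛.antisym {whole A} {Y} (λ _ _ → [])
        (⊑-intro Y (whole A) λ v i v~i → contradiction (v , i , v~i) ∄))
      whole≉Y

    -- The coordinates are unconstrained in the whole space, so no vertex is joined to an earlier
    -- neighbour and every factor is 1 - 0.
    ∏-factor-whole : ∏ (factor (whole A)) ≡ 1ℤ
    ∏-factor-whole = ∏-one (factor (whole A)) λ v →
      cong (λ n → 1ℤ ℤ.+ -1ℤ ℤ.* + n) (none v (joined (whole A) v) refl)
      where
      none : ∀ v is → joined (whole A) v ≡ is → length (joined (whole A) v) ≡ 0
      none v []      eq = cong length eq
      none v (i ∷ _) eq = contradiction
        (⊢⇒≡ (whole A) {λ u → u} (λ _ → []) (joined-~ (whole A) (subst (i ∈_) (sym eq) (here refl))))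
        (λ v≡i → ℕ.<-irrefl (cong rank (sym v≡i)) (rank-< (nb-∈ v i)))

    -- The Möbius recursion and the characteristic polynomial

    isMöbius : IsMöbiusFrom (𝓛 A) (whole A) μ
    isMöbius = record
      { cong = λ {X} {Y} → μ-cong {X} {Y}
      -- The whole space is the least flat, so being equal to it is the same as lying below it.
      ; base = ≡.trans
          (∑-cong forests λ F → cong (weight F ℤ.*_)
            (𝟙-cong (φ F ≋? whole A) (φ F ⊑? whole A) proj₂
              (λ φ⊑ → 𝓛.antisym {φ F} {whole A} φ⊑ (λ _ _ → []))))
          (≡.trans (∑-forests-below (whole A)) ∏-factor-whole)
      ; sum  = λ {Y} _ whole≉Y →
          filter (_⊑? Y) flats , below-lists Y , ∑-below Y whole≉Y
      }
      where
      ⊑-resp-≋ : ∀ Y {X X′} → X ≋ X′ → X ⊑ Y → X′ ⊑ Y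
      ⊑-resp-≋ Y (X⇒X′ , _) X⊑Y p p∈Y = X⇒X′ p (X⊑Y p p∈Y)

      below-lists : ∀ Y → Lists (𝓛 A) (λ Z → whole A ⊑ Z × Z ⊑ Y) (filter (_⊑? Y) flats)
      below-lists Y = SetoidUniqueProperties.filter⁺ 𝓛.Eq.setoid (_⊑? Y) flats-unique , λ Z → mk⇔
        (λ Z∈ → (λ _ _ → []) , proj₂ (SetoidMembershipProperties.∈-filter⁻ 𝓛.Eq.setoid (_⊑? Y)
          (λ {X} {X′} → ⊑-resp-≋ Y {X} {X′}) {v = Z} {xs = flats} Z∈))
        (λ (_ , Z⊑Y) → SetoidMembershipProperties.∈-filter⁺ 𝓛.Eq.setoid (_⊑? Y)
          (λ {X} {X′} → ⊑-resp-≋ Y {X} {X′}) {v = Z} (flats-complete Z) Z⊑Y)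

      ∑-below : ∀ Y → ¬ (whole A ≋ Y) → ∑ (filter (_⊑? Y) flats) μ ≡ 0ℤ
      ∑-below Y whole≉Y = begin
        ∑ (filter (_⊑? Y) flats) μ
          ≡⟨ ∑-filter (_⊑? Y) flats μ ⟩
        ∑ flats (λ X → μ X ℤ.* 𝟙 (X ⊑? Y))
          ≡⟨ ∑-flats (λ X → 𝟙 (X ⊑? Y)) (λ {X} {X′} X≋X′ → 𝟙-cong (X ⊑? Y) (X′ ⊑? Y)
               (⊑-resp-≋ Y {X} {X′} X≋X′) (⊑-resp-≋ Y {X′} {X} (𝓛.Eq.sym {X} {X′} X≋X′))) ⟩
        ∑ forests (λ F → weight F ℤ.* 𝟙 (φ F ⊑? Y))
          ≡⟨ ∑-forests-below Y ⟩
        ∏ (factor Y)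
          ≡⟨ ∏-factor-zero Y whole≉Y ⟩
        0ℤ ∎
        where open ≡-Reasoning

    intersectionData : IntersectionData A
    intersectionData = record
      { flats    = flats
      ; unique   = flats-unique
      ; complete = flats-complete
      ; μ        = μ
      ; isMöbius = isMöbius
      ; dim      = dim
      ; isDim    = hasDimension
      }

    -- Coefficient by coefficient, the sum over flats becomes a signed sum over forests by number of
    -- roots, which factors vertex by vertex.
    isCharacteristicPolynomial : IsCharacteristicPolynomial A (linearFactors (tabulate deg))
    isCharacteristicPolynomial = intersectionData , λ k → begin
      coeff (∑ₚ (map (λ X → monomial (μ X) (dim X)) flats)) k
        ≡⟨ coeff-∑ₚ flats (λ X → monomial (μ X) (dim X)) k ⟩
      ∑ flats (λ X → coeff (monomial (μ X) (dim X)) k)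
        ≡⟨ ∑-cong flats (λ X → coeff-monomial (μ X) (dim X) k) ⟩
      ∑ flats (λ X → μ X ℤ.* δ (dim X) k)
        ≡⟨ ∑-flats (λ X → δ (dim X) k) (λ {X} {Y} X≋Y → cong (λ n → δ n k) (dim-cong {X} {Y} X≋Y)) ⟩
      ∑ forests (λ F → weight F ℤ.* δ (dim (φ F)) k)
        ≡⟨ ∑-cong forests (λ F → cong (λ n → weight F ℤ.* δ n k) (dim-φ F)) ⟩
      ∑ forests (λ F → weight F ℤ.* δ (count (λ v → is-nothing (F v))) k)
        ≡⟨ ∑-options-linear deg k ⟩
      coeff (linearFactors (tabulate deg)) k ∎
      where open ≡-Reasoning

-- The homogenized Shi arrangement as a graphic arrangement

-- Recursion on the index, parallel to that of `tabulate`, makes the list of all lengths easy to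
-- compute.
above : ∀ {n} → Fin n → List (Fin n)
above zero    = tabulate suc
above (suc i) = map suc (above i)

∈-above⁺ : ∀ {n} {i j : Fin n} → i Fin.< j → j ∈ above i
∈-above⁺ {i = zero}  {suc j} _         = ∈-tabulate⁺ j
∈-above⁺ {i = suc i} {suc j} (s≤s i<j) = ∈-map⁺ suc (∈-above⁺ i<j)

∈-above⁻ : ∀ {n} {i j : Fin n} → j ∈ above i → i Fin.< j
∈-above⁻ {i = zero}  j∈ with _ , refl ← ∈-tabulate⁻ j∈ = s≤s z≤n
∈-above⁻ {i = suc i} j∈ with _ , k∈ , refl ← ∈-map⁻ suc j∈ = s≤s (∈-above⁻ k∈)

above-unique : ∀ {n} (i : Fin n) → Unique (above i)
above-unique zero    = Unique.tabulate⁺ Fin.suc-injective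
above-unique (suc i) = Unique.map⁺ Fin.suc-injective (above-unique i)

tabulate-above : ∀ n → tabulate {n = n} (λ i → length (above i)) ≡ downFrom n
tabulate-above zero    = refl
tabulate-above (suc n) = cong₂ _∷_ (List.length-tabulate {n = n} suc)
  (≡.trans (List.tabulate-cong λ i → List.length-map suc (above i)) (tabulate-above n))

-- `inject₁` omits the last index, the only one with nothing above it, so the lengths stop at 1 and
-- not at 0.
tabulate-above-inject₁ : ∀ n → tabulate {n = n} (λ i → length (above (inject₁ i))) ≡ applyDownFrom ℕ.suc n
tabulate-above-inject₁ zero    = refl
tabulate-above-inject₁ (suc n) = cong₂ _∷_ (List.length-tabulate {n = suc n} suc)
  (≡.trans (List.tabulate-cong λ i → List.length-map suc (above (inject₁ i))) (tabulate-above-inject₁ n))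

tabulate-+ : ∀ {a} {A : Set a} n {m} (f : Fin (n ℕ.+ m) → A) →
             tabulate f ≡ tabulate (λ i → f (i ↑ˡ m)) ++ tabulate (λ i → f (n ↑ʳ i))
tabulate-+ zero    f = refl
tabulate-+ (suc n) f = cong (f zero ∷_) (tabulate-+ n (f ∘ suc))

double : List ℕ → List ℕ
double = concatMap (λ i → i ∷ i ∷ [])

double-↭ : ∀ is → is ++ is ↭ double is
double-↭ []       = ↭-refl
double-↭ (i ∷ is) = prep i (trans (↭.shift i is is) (prep i (double-↭ is)))

downFrom-↭ : ∀ m → downFrom (suc m) ↭ 0 ∷ applyDownFrom ℕ.suc m
downFrom-↭ zero    = ↭-refl
downFrom-↭ (suc m) = trans (prep (suc m) (downFrom-↭ m)) (swap (suc m) 0 ↭-refl)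

applyDownFrom-↭ : ∀ m → applyDownFrom ℕ.suc m ↭ applyUpTo ℕ.suc m
applyDownFrom-↭ m = trans (↭-reflexive (sym (List.reverse-applyUpTo ℕ.suc m)))
                          (↭.↭-reverse (applyUpTo ℕ.suc m))

-- The degrees of the xᵢ are m, ..., 0 and those of the zᵢ are m, ..., 1: each positive one occurs
-- twice, and 0 once.
degrees-↭ : ∀ m → downFrom (suc m) ++ applyDownFrom ℕ.suc m ↭ 0 ∷ double (applyUpTo ℕ.suc m)
degrees-↭ m = begin
  downFrom (suc m) ++ applyDownFrom ℕ.suc m
    ↭⟨ ↭.++⁺ (trans (downFrom-↭ m) (prep 0 (applyDownFrom-↭ m))) (applyDownFrom-↭ m) ⟩
  0 ∷ applyUpTo ℕ.suc m ++ applyUpTo ℕ.suc m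
    ↭⟨ prep 0 (double-↭ (applyUpTo ℕ.suc m)) ⟩
  0 ∷ double (applyUpTo ℕ.suc m) ∎
  where open PermutationReasoning

∏-squares : ∀ is → foldr _*ₚ_ 1ₚ (map (λ i → (t- i) ^ₚ 2) is) ≈ₚ linearFactors (double is)
∏-squares []       k = refl
∏-squares (i ∷ is) k = ≡.trans
  (*ₚ-congˡ ((t- i) ^ₚ 2) (foldr _*ₚ_ 1ₚ (map (λ i → (t- i) ^ₚ 2) is)) (linearFactors (double is))
    (∏-squares is) k)
  (^ₚ2-* (t- i) (linearFactors (double is)) k)

-- The chordal graph of the homogenized Shi arrangement

module ShiGraph (m : ℕ) where

  X : Fin (suc m) → Fin (suc m ℕ.+ m)
  X i = i ↑ˡ m

  -- The position of yᵢ, which carries zᵢ = xᵢ - yᵢ after the change of coordinates.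
  Z : Fin m → Fin (suc m ℕ.+ m)
  Z i = suc m ↑ʳ i

  X-injective : ∀ {i j} → X i ≡ X j → i ≡ j
  X-injective {i} {j} = Fin.↑ˡ-injective m i j

  data Split : Fin (suc m ℕ.+ m) → Set where
    x : ∀ i → Split (X i)
    z : ∀ i → Split (Z i)

  split : ∀ v → Split v
  split v with splitAt (suc m) v in eq
  ... | inj₁ i = subst Split (Fin.splitAt⁻¹-↑ˡ eq) (x i)
  ... | inj₂ i = subst Split (Fin.splitAt⁻¹-↑ʳ eq) (z i)

  -- xᵢ and zᵢ share an index because they have the same earlier neighbours, the xⱼ with j > i.
  index : Fin (suc m ℕ.+ m) → Fin (suc m)
  index v = [ (λ i → i) , inject₁ ]′ (splitAt (suc m) v)

  index-X : ∀ i → index (X i) ≡ i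
  index-X i = cong [ (λ i → i) , inject₁ ]′ (Fin.splitAt-↑ˡ (suc m) i m)

  index-Z : ∀ i → index (Z i) ≡ inject₁ i
  index-Z i = cong [ (λ i → i) , inject₁ ]′ (Fin.splitAt-↑ʳ (suc m) m i)

  earlier : Fin (suc m ℕ.+ m) → List (Fin (suc m ℕ.+ m))
  earlier v = map X (above (index v))

  ∈-earlier⁺ : ∀ v {j} → index v Fin.< j → X j ∈ earlier v
  ∈-earlier⁺ v i<j = ∈-map⁺ X (∈-above⁺ i<j)

  ∈-earlier⁻ : ∀ v {w} → w ∈ earlier v → ∃ λ j → index v Fin.< j × w ≡ X j
  ∈-earlier⁻ v w∈ with j , j∈ , eq ← ∈-map⁻ X w∈ = j , ∈-above⁻ j∈ , eq

  X∈earlier-X : ∀ {i j} → i Fin.< j → X j ∈ earlier (X i)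
  X∈earlier-X {i} {j} i<j = ∈-earlier⁺ (X i) (subst (Fin._< j) (sym (index-X i)) i<j)

  graph : ChordalGraph (suc m ℕ.+ m)
  graph = record
    { earlier = earlier
    ; unique  = λ v → Unique.map⁺ X-injective (above-unique (index v))
    ; rank    = rank
    ; rank-<  = λ {v} → rank-< v
    ; clique  = λ {_} {v} → clique v
    }
    where
    rank : Fin (suc m ℕ.+ m) → ℕ
    -- All indices are below `suc m`, so the truncated subtraction strictly reverses their order.
    rank v = suc m ∸ toℕ (index v)
    rank-< : ∀ v {w} → w ∈ earlier v → rank w < rank v
    rank-< v w∈ with j , i<j , refl ← ∈-earlier⁻ v w∈ rewrite index-X j =
      ℕ.∸-monoʳ-< i<j (ℕ.<⇒≤ (Fin.toℕ<n j))
    -- Earlier neighbours are always `X` vertices, and any two distinct ones of these are adjacent.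
    clique : ∀ v {u w} → u ∈ earlier v → w ∈ earlier v → u ≢ w → u ∈ earlier w ⊎ w ∈ earlier u
    clique v u∈ w∈ u≢w
      with i , _ , refl ← ∈-earlier⁻ v u∈ | j , _ , refl ← ∈-earlier⁻ v w∈ with Fin.<-cmp i j
    ... | tri< i<j _ _    = inj₂ (X∈earlier-X i<j)
    ... | tri≈ _ refl _   = contradiction refl u≢w
    ... | tri> _ _ j<i    = inj₁ (X∈earlier-X j<i)

  degrees : tabulate (ChordalGraph.deg graph) ≡ downFrom (suc m) ++ applyDownFrom ℕ.suc m
  degrees = begin
    tabulate deg
      ≡⟨ tabulate-+ (suc m) deg ⟩
    tabulate (deg ∘ X) ++ tabulate (deg ∘ Z)
      ≡⟨ cong₂ _++_ (List.tabulate-cong deg-X) (List.tabulate-cong deg-Z) ⟩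
    tabulate {n = suc m} (λ i → length (above i)) ++
    tabulate {n = m} (λ i → length (above (inject₁ i)))
      ≡⟨ cong₂ _++_ (tabulate-above (suc m)) (tabulate-above-inject₁ m) ⟩
    downFrom (suc m) ++ applyDownFrom ℕ.suc m ∎
    where
    open ≡-Reasoning
    deg = ChordalGraph.deg graph
    deg-X : ∀ i → deg (X i) ≡ length (above i)
    deg-X i = ≡.trans (List.length-map X (above (index (X i)))) (cong (length ∘ above) (index-X i))
    deg-Z : ∀ i → deg (Z i) ≡ length (above (inject₁ i))
    deg-Z i = ≡.trans (List.length-map X (above (index (Z i)))) (cong (length ∘ above) (index-Z i))

linearFactors-degrees : ∀ m → linearFactors (tabulate (ChordalGraph.deg (ShiGraph.graph m))) ≈ₚ
                        (t *ₚ ∏₁ m (λ i → (t- i) ^ₚ 2))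
linearFactors-degrees m k = begin
  coeff (linearFactors (tabulate (ChordalGraph.deg (ShiGraph.graph m)))) k
    -- The factor for degree 0 is `t- 0`, which computes to `t`.
    ≡⟨ linearFactors-↭ (trans (↭-reflexive (ShiGraph.degrees m)) (degrees-↭ m)) k ⟩
  coeff (t *ₚ linearFactors (double (applyUpTo ℕ.suc m))) k
    ≡⟨ *ₚ-congˡ t (∏₁ m (λ i → (t- i) ^ₚ 2)) (linearFactors (double (applyUpTo ℕ.suc m)))
         (∏-squares (applyUpTo ℕ.suc m)) k ⟨
  coeff (t *ₚ ∏₁ m (λ i → (t- i) ^ₚ 2)) k ∎
  where open ≡-Reasoning

module _ {c ℓ₁ ℓ₂} (K : HeytingField c ℓ₁ ℓ₂) where
  open HeytingField K using (_≈_; 0#; Carrier; setoid; _*_; _+_; reflexive)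
    renaming (refl to ≈-refl; sym to ≈-sym; trans to ≈-trans)
  open HeytingCommutativeRing (HeytingField.heytingCommutativeRing K) using (commutativeRing)
  open CommutativeRing commutativeRing
    using (semiring; ring; +-abelianGroup; +-commutativeMonoid; +-cong; +-comm; *-comm; -_; _-_;
           -‿cong; -‿inverseʳ)
  open CommutativeMonoid +-commutativeMonoid using ()
    renaming (commutativeSemigroup to +-commutativeSemigroup)
  open SemiringSum semiring using (sum; sum-cong-≋)
  open AbelianGroupProperties +-abelianGroup
    using (x∙y⁻¹≈ε⇒x≈y; x≈y⇒x∙y⁻¹≈ε; ⁻¹-∙-comm; ⁻¹-anti-homo-//; //-rightDividesˡ)
  open CommutativeSemigroupProperties +-commutativeSemigroup using (interchange; xy∙z≈xz∙y)
  open RingProperties ring using (x[y-z]≈xy-xz; [y-z]x≈yx-zx)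
  open Arrangements K hiding (x; y)
  open GraphicArrangements K using (sum-coordinate; IsGraphic)

  -- Subtraction and the evaluation of covectors

  -‿cong₂ : ∀ {p q r s} → p ≈ q → r ≈ s → (p - r) ≈ (q - s)
  -‿cong₂ p≈q r≈s = +-cong p≈q (-‿cong r≈s)

  x-[x-y]≈y : ∀ p q → (p - (p - q)) ≈ q
  x-[x-y]≈y p q = begin
    p - (p - q)   ≈⟨ +-cong ≈-refl (⁻¹-anti-homo-// p q) ⟩
    p + (q - p)   ≈⟨ +-comm p (q - p) ⟩
    (q - p) + p   ≈⟨ //-rightDividesˡ p q ⟩
    q             ∎
    where open ≈-Reasoning setoid

  sum-sub : ∀ {d} (f g : Vector Carrier d) → sum (λ k → f k - g k) ≈ (sum f - sum g)
  sum-sub {zero}  f g = ≈-sym (-‿inverseʳ 0#)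
  sum-sub {suc d} f g = begin
    (f zero - g zero) + sum (λ k → f (suc k) - g (suc k))
      ≈⟨ +-cong ≈-refl (sum-sub (f ∘ suc) (g ∘ suc)) ⟩
    (f zero - g zero) + (sum (f ∘ suc) - sum (g ∘ suc))
      ≈⟨ interchange (f zero) (- g zero) (sum (f ∘ suc)) (- sum (g ∘ suc)) ⟩
    (f zero + sum (f ∘ suc)) + (- g zero - sum (g ∘ suc))
      ≈⟨ +-cong ≈-refl (⁻¹-∙-comm (g zero) (sum (g ∘ suc))) ⟩
    (f zero + sum (f ∘ suc)) - (g zero + sum (g ∘ suc)) ∎
    where open ≈-Reasoning setoid

  infixl 7 _·_
  _·_ : ∀ {d} → Vector Carrier d → Point d → Carrier
  u · p = sum (λ k → u k * p k)

  ·-sub : ∀ {d} (u w : Vector Carrier d) p → (λ k → u k - w k) · p ≈ (u · p - w · p)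
  ·-sub {d} u w p = ≈-trans
    (sum-cong-≋ {d} {λ k → (u k - w k) * p k} {λ k → u k * p k - w k * p k}
      λ k → [y-z]x≈yx-zx (p k) (u k) (w k))
    (sum-sub (λ k → u k * p k) (λ k → w k * p k))

  ·-coordinate : ∀ {d} (i : Fin d) p → coordinate i · p ≈ p i
  ·-coordinate {d} i p = ≈-trans
    (sum-cong-≋ {d} {λ k → coordinate i k * p k} {λ k → p k * coordinate i k} λ k → *-comm _ _)
    (sum-coordinate p i)

  module _ (m : ℕ) where
    open ShiGraph m

    -- The change of coordinates and the hyperplanes

    τ : Point (suc m ℕ.+ m) → Point (suc m ℕ.+ m)
    τ p v = [ (λ i → p (X i)) , (λ i → p (X (inject₁ i)) - p (Z i)) ]′ (splitAt (suc m) v)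

    τ-X : ∀ p i → τ p (X i) ≡ p (X i)
    τ-X p i = cong [ _ , _ ]′ (Fin.splitAt-↑ˡ (suc m) i m)

    τ-Z : ∀ p i → τ p (Z i) ≡ p (X (inject₁ i)) - p (Z i)
    τ-Z p i = cong [ _ , _ ]′ (Fin.splitAt-↑ʳ (suc m) m i)

    τ-cong : ∀ {p q} → (∀ v → p v ≈ q v) → ∀ v → τ p v ≈ τ q v
    τ-cong p≈q v with splitAt (suc m) v
    ... | inj₁ i = p≈q (X i)
    ... | inj₂ i = -‿cong₂ (p≈q (X (inject₁ i))) (p≈q (Z i))

    -- xᵢ is kept, and zᵢ = xᵢ - yᵢ gives back yᵢ = xᵢ - zᵢ.
    τ-involutive : ∀ p v → τ (τ p) v ≈ p v
    τ-involutive p v with split v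
    ... | x i = reflexive (≡.trans (τ-X (τ p) i) (τ-X p i))
    ... | z i = begin
      τ (τ p) (Z i)                                  ≡⟨ τ-Z (τ p) i ⟩
      τ p (X (inject₁ i)) - τ p (Z i)                ≡⟨ cong₂ _-_ (τ-X p (inject₁ i)) (τ-Z p i) ⟩
      p (X (inject₁ i)) - (p (X (inject₁ i)) - p (Z i)) ≈⟨ x-[x-y]≈y _ _ ⟩
      p (Z i)                                        ∎
      where open ≈-Reasoning setoid

    τ-combination : ∀ {k} (a : Vector Carrier k) v j →
                    τ (combination a v) j ≈ combination a (τ ∘ v) j
    τ-combination {k} a v j with splitAt (suc m) j
    ... | inj₁ i = ≈-refl
    ... | inj₂ i = ≈-sym (≈-trans
      (sum-cong-≋ {k} {λ l → a l * (v l (X (inject₁ i)) - v l (Z i))}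
                      {λ l → a l * v l (X (inject₁ i)) - a l * v l (Z i)}
                      (λ l → x[y-z]≈xy-xz (a l) _ _))
      (sum-sub (λ l → a l * v l (X (inject₁ i))) (λ l → a l * v l (Z i))))

    braid-lies : ∀ (e : IndexPair (suc m)) p → let open IndexPair e in
                 p liesOn braid e ⇔ τ p (X i) ≈ τ p (X j)
    braid-lies e p = mk⇔
      (λ p∈ → ≈-trans (reflexive (τ-X p i)) (≈-trans
        (x∙y⁻¹≈ε⇒x≈y _ _ (≈-trans (≈-sym value) p∈)) (reflexive (sym (τ-X p j)))))
      (λ eq → ≈-trans value (x≈y⇒x∙y⁻¹≈ε
        (≈-trans (reflexive (sym (τ-X p i))) (≈-trans eq (reflexive (τ-X p j))))))
      where
      open IndexPair e
      value : Hyperplane.normal (braid e) · p ≈ (p (X i) - p (X j))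
      value = ≈-trans (·-sub (coordinate (X i)) (coordinate (X j)) p)
                      (-‿cong₂ (·-coordinate (X i) p) (·-coordinate (X j) p))

    -- Both sides have the same underlying number; this aligns yᵢ with xᵢ.
    inject₁-i′ : (e : IndexPair (suc m)) → inject₁ (IndexPair.i′ e) ≡ IndexPair.i e
    inject₁-i′ e = Fin.toℕ-injective (≡.trans (Fin.toℕ-inject₁ i′) (Fin.toℕ-fromℕ< _))
      where open IndexPair e

    -- The equation xᵢ - xⱼ = yᵢ rearranges to xᵢ - yᵢ = xⱼ, which equates two coordinates of `τ p`.
    shi-lies : ∀ (e : IndexPair (suc m)) p → let open IndexPair e in
               p liesOn shi e ⇔ τ p (Z i′) ≈ τ p (X j)
    shi-lies e p = mk⇔
      (λ p∈ → ≈-trans (reflexive τ-Zi) (≈-trans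
        (x∙y⁻¹≈ε⇒x≈y _ _ (≈-trans (≈-sym value) p∈)) (reflexive (sym (τ-X p j)))))
      (λ eq → ≈-trans value (x≈y⇒x∙y⁻¹≈ε
        (≈-trans (reflexive (sym τ-Zi)) (≈-trans eq (reflexive (τ-X p j))))))
      where
      open IndexPair e
      open ≈-Reasoning setoid
      τ-Zi : τ p (Z i′) ≡ p (X i) - p (Z i′)
      τ-Zi = ≡.trans (τ-Z p i′) (cong (λ k → p (X k) - p (Z i′)) (inject₁-i′ e))
      value : Hyperplane.normal (shi e) · p ≈ ((p (X i) - p (Z i′)) - p (X j))
      value = begin
        Hyperplane.normal (shi e) · p
          ≈⟨ ·-sub (λ k → coordinate (X i) k - coordinate (X j) k) (coordinate (Z i′)) p ⟩
        (λ k → coordinate (X i) k - coordinate (X j) k) · p - coordinate (Z i′) · p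
          ≈⟨ -‿cong₂ (·-sub (coordinate (X i)) (coordinate (X j)) p) ≈-refl ⟩
        (coordinate (X i) · p - coordinate (X j) · p) - coordinate (Z i′) · p
          ≈⟨ -‿cong₂ (-‿cong₂ (·-coordinate (X i) p) (·-coordinate (X j) p)) (·-coordinate (Z i′) p) ⟩
        (p (X i) - p (X j)) - p (Z i′)
          ≈⟨ xy∙z≈xz∙y (p (X i)) (- p (X j)) (- p (Z i′)) ⟩
        (p (X i) - p (Z i′)) - p (X j) ∎

    ∈-indexPairs : ∀ {n} (e : IndexPair n) → e ∈ indexPairs n
    ∈-indexPairs {n} (pair i j i<j) = Any.mapMaybe⁺ increasing (cartesianProduct (allFin n) (allFin n))
      (Any.map⁺ (Any.map (λ { refl → increasing-just }) (∈-cartesianProduct⁺ (∈-allFin i) (∈-allFin j))))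
      where
      increasing-just : Maybe.Any (pair i j i<j ≡_) (increasing (i , j))
      increasing-just with i Fin.<? j
      -- The decision returns its own proof of the inequality, which equals the given one by
      -- irrelevance.
      ... | yes p = just (cong (pair i j) (ℕ.≤-irrelevant i<j p))
      ... | no ¬p = contradiction i<j ¬p

    isGraphic : IsGraphic graph (𝓗𝓢 (suc m))
    isGraphic = record
      { τ               = τ
      ; τ-cong          = τ-cong
      ; τ-involutive    = τ-involutive
      ; τ-combination   = τ-combination
      ; edge⇒hyperplane = λ {v} → edge⇒hyperplane v
      ; hyperplane⇒edge = hyperplane⇒edge
      }
      where
      Cuts : Hyperplane (suc m ℕ.+ m) → (v w : Fin (suc m ℕ.+ m)) → Set _
      Cuts H v w = ∀ p → p liesOn H ⇔ τ p v ≈ τ p w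

      edge⇒hyperplane : ∀ v {w} → w ∈ earlier v → ∃ λ H → H ∈ 𝓗𝓢 (suc m) × Cuts H v w
      edge⇒hyperplane v w∈ with j , i<j , refl ← ∈-earlier⁻ v w∈ with split v
      ... | x i = braid e , ∈-++⁺ˡ (∈-map⁺ braid (∈-indexPairs e)) , braid-lies e
        where e = pair i j (subst (Fin._< j) (index-X i) i<j)
      ... | z i = shi e , ∈-++⁺ʳ (map braid (indexPairs (suc m))) (∈-map⁺ shi (∈-indexPairs e)) ,
                  -- `shi-lies` speaks of `i′` of `e`, which is `i` because `inject₁` is injective.
                  subst (λ k → Cuts (shi e) (Z k) (X j)) (Fin.inject₁-injective (inject₁-i′ e)) (shi-lies e)
        where e = pair (inject₁ i) j (subst (Fin._< j) (index-Z i) i<j)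

      hyperplane⇒edge : ∀ {H} → H ∈ 𝓗𝓢 (suc m) → ∃₂ λ v w → w ∈ earlier v × Cuts H v w
      hyperplane⇒edge H∈ with ∈-++⁻ (map braid (indexPairs (suc m))) H∈
      ... | inj₁ H∈braid with e , _ , refl ← ∈-map⁻ braid H∈braid =
        X i , X j , X∈earlier-X i<j , braid-lies e
        where open IndexPair e
      ... | inj₂ H∈shi with e , _ , refl ← ∈-map⁻ shi H∈shi =
        Z i′ , X j , ∈-earlier⁺ (Z i′) (subst (Fin._< j) i≡ i<j) , shi-lies e
        where
        open IndexPair e
        i≡ : i ≡ index (Z i′)
        i≡ = sym (≡.trans (index-Z i′) (inject₁-i′ e))

theorem5p1 : ∀ {c ℓ₁ ℓ₂ ℓ₃} (ℝ : RealNumbers c ℓ₁ ℓ₂ ℓ₃) →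
    let open RealNumbers ℝ using (heytingField)
        open Arrangements heytingField
    in (n : ℕ) → 1 ≤ n →
       IsCharacteristicPolynomial (𝓗𝓢 n) (t *ₚ ∏₁ (pred n) (λ i → (t- i) ^ₚ 2))
-- The intersection data of the graphic arrangement are kept; only the product of the factors t -
-- deg v is rewritten.
theorem5p1 ℝ (suc m) _ = proj₁ χ , λ k → ≡.trans (proj₂ χ k) (linearFactors-degrees m k)
  where
  open RealNumbers ℝ using (heytingField)
  open GraphicArrangements heytingField using (module CharacteristicPolynomial)
  χ = CharacteristicPolynomial.isCharacteristicPolynomial (isGraphic heytingField m)
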